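{- Let $G$ be a finite planar graph in which no triangle is adjacent to a triangle or to a $4$-cycle, and each $5$-cycle is adjacent to at most three triangles. Then $\mathrm{mad}(G)<4$. Hence $G$ is adaptably $3$-choosable and $(3,1)$-choosable.
   Context: A triangle is a $3$-cycle; two cycles are adjacent if they share a common edge. $\mathrm{mad}(G)=\max\{2|E(H)|/|V(H)| : H \text{ a subgraph of } G\}$. Given a (possibly improper) edge coloring $F$ of $G$ with integers, a vertex coloring $c$ is adapted to $F$ if no edge $uv$ satisfies $c(u)=c(v)=F(uv)$. $G$ is adaptably $k$-choosable if for every edge coloring $F$ and every list assignment $L$ with $|L(v)|\ge k$ for all $v$, there is a coloring $c$ adapted to $F$ with $c(v)\in L(v)$ for all $v$. A $(k,d)$-list assignment assigns to each vertex a list of at least $k$ colors such that adjacent vertices' lists share at most $d$ colors; $G$ is $(k,d)$-choosable if for every such assignment there is a proper vertex coloring from the lists. -}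

module Defs where

open import Data.Bool using (Bool; true; false; T; T?)
open import Data.Fin using (Fin; toℕ; _<?_)
open import Data.Fin.Properties using (all?)
open import Data.Fin.Subset using (Subset; ∣_∣; _∈_)
open import Data.Fin.Subset.Properties using (_∈?_)
open import Data.Integer as ℤ using (ℤ)
open import Data.List using (List; []; _∷_; [_]; length; map; filter; allFin; cartesianProduct; cartesianProductWith)
open import Data.List.Membership.Propositional using () renaming (_∈_ to _∈ˡ_)
open import Data.List.Membership.Propositional.Properties using (∈-cartesianProductWith⁺; ∈-filter⁺; ∈-map⁺)
open import Data.List.Relation.Unary.Any as Any using (here; there)
open import Data.List.Relation.Unary.Unique.Propositional using (Unique)
open import Data.Nat using (ℕ; zero; suc; _+_; _*_; _≤_; _≥_)
open import Data.Nat.DivMod using (_mod_)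
open import Data.Product using (∃; ∃₂; _×_; _,_)
open import Data.Rational as ℚ using (ℚ; 0ℚ)
import Data.Rational.Properties as ℚ
open import Relation.Binary using (Rel; DecTotalOrder)
open import Data.List.Extrema (DecTotalOrder.totalOrder ℚ.≤-decTotalOrder) using (max; v≤max⁺)
open import Data.Sum using (_⊎_; inj₂)
open import Data.Vec using (Vec; []; _∷_; lookup)
open import Function using (_↔_; _⇔_; Injective; Surjective; module Inverse)
open import Level using (0ℓ)
open import Relation.Binary.Construct.Closure.ReflexiveTransitive using (Star)
open import Relation.Binary.PropositionalEquality using (_≡_; _≢_; refl)
open import Relation.Nullary using (Dec; ¬_; ¬?)
open import Relation.Nullary.Decidable using (map′; _×-dec_; _→-dec_)
import Data.List.Membership.DecPropositional as DecMembership

open DecMembership ℤ._≟_ using () renaming (_∈?_ to _∈ℤ?_)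

private variable
  n k : ℕ

record Graph (n : ℕ) : Set where
  field
    adj    : Fin n → Fin n → Bool
    sym    : ∀ {u v} → T (adj u v) → T (adj v u)
    irrefl : ∀ {v} → ¬ T (adj v v)

  _~_ : Rel (Fin n) 0ℓ
  u ~ v = T (adj u v)

  Isolated : Fin n → Set
  Isolated v = ∀ u → ¬ (v ~ u)

  isolated? : ∀ v → Dec (Isolated v)
  isolated? v = all? λ u → ¬? (T? (adj v u))

-- Number of unordered pairs {u , v} related by a symmetric Boolean matrix.
edgeCount : (Fin n → Fin n → Bool) → ℕ
edgeCount {n} a =
  length (filter (λ (u , v) → u <? v ×-dec T? (a u v)) (cartesianProduct (allFin n) (allFin n)))

-- An edge with one of its two orientations.
record Dart (G : Graph n) : Set where
  constructor dart
  open Graph G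
  field
    src tgt : Fin n
    edge    : src ~ tgt

module _ {G : Graph n} where
  open Dart

  rev : Dart G → Dart G
  rev d = dart (tgt d) (src d) (Graph.sym G (edge d))

-- The relation R is an equivalence with exactly k classes.
record Classes {A : Set} (R : Rel A 0ℓ) (k : ℕ) : Set where
  field
    class      : A → Fin k
    surjective : Surjective _≡_ _≡_ class
    complete   : ∀ x y → class x ≡ class y ⇔ R x y

-- For a permutation f of a finite set this is "x and y lie on the same
-- cycle of f".
Orbit : {A : Set} → (A → A) → Rel A 0ℓ
Orbit f = Star (λ x y → f x ≡ y)

record Rotation (G : Graph n) : Set where
  open Dart
  field
    perm   : Dart G ↔ Dart G
    fix    : ∀ d → src (Inverse.to perm d) ≡ src d
    cyclic : ∀ d e → src d ≡ src e → Orbit (Inverse.to perm) d e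

  -- Walk along d, then leave its end by the successor of the reversed dart.
  -- The orbits are the facial walks.
  faceStep : Dart G → Dart G
  faceStep d = Inverse.to perm (rev d)

-- A combinatorial embedding (rotation system) of genus 0:
-- Euler's formula V − E + F = 2C, where every component is embedded in a
-- sphere of its own.  An isolated vertex has one face, which carries no dart,
-- so it is counted separately.  Since V − E + F ≤ 2 holds for each component,
-- the summed equation says that every component has genus 0.
record Planar (G : Graph n) : Set where
  open Graph G
  field
    rotation        : Rotation G
    faceCount       : ℕ
    faces           : Classes (Orbit (Rotation.faceStep rotation)) faceCount
    componentCount  : ℕ
    components      : Classes (Star _~_) componentCount
    euler           : n + (faceCount + length (filter isolated? (allFin n)))
                    ≡ edgeCount adj + 2 * componentCount

next : Fin k → Fin k
next {suc k} i = suc (toℕ i) mod suc k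

-- Meaningful for k ≥ 3 only.
record Cycle (G : Graph n) (k : ℕ) : Set where
  open Graph G
  field
    vertex    : Fin k → Fin n
    injective : Injective _≡_ _≡_ vertex
    closed    : ∀ i → vertex i ~ vertex (next i)

  HasEdge : Rel (Fin n) 0ℓ
  HasEdge u v = ∃ λ i → (vertex i ≡ u × vertex (next i) ≡ v)
                      ⊎ (vertex i ≡ v × vertex (next i) ≡ u)

Triangle : Graph n → Set
Triangle G = Cycle G 3

module _ {G : Graph n} where
  open Cycle

  -- A cycle is a subgraph: the starting vertex and the direction of the
  -- parametrisation are forgotten.
  SameCycle : ∀ {k l} → Cycle G k → Cycle G l → Set
  SameCycle C D = ∀ u v → HasEdge C u v ⇔ HasEdge D u v

  Adjacent : ∀ {k l} → Cycle G k → Cycle G l → Set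
  Adjacent C D = ∃₂ λ u v → HasEdge C u v × HasEdge D u v

  _AdjacentToAtMost_Triangles : ∀ {k} → Cycle G k → ℕ → Set
  C AdjacentToAtMost b Triangles =
    ∀ m (Ts : Fin m → Triangle G) →
    (∀ i j → i ≢ j → ¬ SameCycle (Ts i) (Ts j)) →
    (∀ i → Adjacent C (Ts i)) →
    m ≤ b

NoTriangleAdjacentToTriangle : Graph n → Set
NoTriangleAdjacentToTriangle G =
  (C D : Triangle G) → ¬ SameCycle C D → ¬ Adjacent C D

NoTriangleAdjacentTo4Cycle : Graph n → Set
NoTriangleAdjacentTo4Cycle G =
  (C : Triangle G) (D : Cycle G 4) → ¬ Adjacent C D

5CyclesAdjacentToAtMost3Triangles : Graph n → Set
5CyclesAdjacentToAtMost3Triangles G =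
  (C : Cycle G 5) → C AdjacentToAtMost 3 Triangles

-- A vertex set and an adjacency matrix, in a first-order representation so
-- that the subgraphs of a graph can be listed.
record Sub (n : ℕ) : Set where
  constructor sub
  field
    vertices : Subset n
    matrix   : Vec (Subset n) n

  entry : Fin n → Fin n → Bool
  entry u v = lookup (lookup matrix u) v

record IsSubgraph (G : Graph n) (H : Sub n) : Set where
  constructor isSubgraph
  open Graph G
  open Sub H
  field
    entry-sym : ∀ u v → T (entry u v) → T (entry v u)
    ⊆-edges   : ∀ u v → T (entry u v) → u ~ v
    endpoint  : ∀ u v → T (entry u v) → u ∈ vertices

isSubgraph? : (G : Graph n) (H : Sub n) → Dec (IsSubgraph G H)
isSubgraph? G H =
  map′ (λ (s , e , p) → isSubgraph s e p) (λ (isSubgraph s e p) → s , e , p)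
    (  (all? λ u → all? λ v → T? (entry u v) →-dec T? (entry v u))
    ×-dec (all? λ u → all? λ v → T? (entry u v) →-dec T? (adj u v))
    ×-dec (all? λ u → all? λ v → T? (entry u v) →-dec u ∈? vertices))
  where open Graph G; open Sub H

allVecs : {A : Set} → List A → ∀ n → List (Vec A n)
allVecs xs zero    = [ [] ]
allVecs xs (suc n) = cartesianProductWith _∷_ xs (allVecs xs n)

allSubsets : ∀ n → List (Subset n)
allSubsets = allVecs (true ∷ false ∷ [])

subgraphs : Graph n → List (Sub n)
subgraphs {n} G =
  filter (isSubgraph? G) (cartesianProductWith sub (allSubsets n) (allVecs (allSubsets n) n))

-- 2e / v, and 0 for the null graph.
averageDegree′ : (e v : ℕ) → ℚ
averageDegree′ e zero    = 0ℚ
averageDegree′ e (suc v) = ℤ.+ (2 * e) ℚ./ suc v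

averageDegree : Sub n → ℚ
averageDegree H = averageDegree′ (edgeCount entry) ∣ vertices ∣
  where open Sub H

-- As average degrees are nonnegative, the default value 0 of the maximum and
-- the null subgraph only matter for the null graph, which gets mad 0.
mad : Graph n → ℚ
mad G = max 0ℚ (map averageDegree (subgraphs G))

allVecs-complete : {A : Set} {xs : List A} → (∀ x → x ∈ˡ xs) → (v : Vec A n) → v ∈ˡ allVecs xs n
allVecs-complete p []      = here refl
allVecs-complete p (x ∷ v) = ∈-cartesianProductWith⁺ _∷_ (p x) (allVecs-complete p v)

allSubsets-complete : (S : Subset n) → S ∈ˡ allSubsets n
allSubsets-complete = allVecs-complete λ where
  true  → here refl
  false → there (here refl)

subgraphs-complete : (G : Graph n) (H : Sub n) → IsSubgraph G H → H ∈ˡ subgraphs G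
subgraphs-complete G H =
  ∈-filter⁺ (isSubgraph? G)
    (∈-cartesianProductWith⁺ sub (allSubsets-complete _) (allVecs-complete allSubsets-complete _))

averageDegree≤mad : (G : Graph n) (H : Sub n) → IsSubgraph G H → averageDegree H ℚ.≤ mad G
averageDegree≤mad G H H⊆G =
  v≤max⁺ 0ℚ _ (inj₂ (Any.map (λ { refl → ℚ.≤-refl })
    (∈-map⁺ averageDegree (subgraphs-complete G H H⊆G))))

Colour : Set
Colour = ℤ

record ListAssignment (n k : ℕ) : Set where
  field
    list   : Fin n → List Colour
    unique : ∀ v → Unique (list v)
    large  : ∀ v → length (list v) ≥ k

record EdgeColouring (G : Graph n) : Set where
  field
    colour     : Dart G → Colour
    undirected : ∀ d → colour (rev d) ≡ colour d

_FromLists_ : (Fin n → Colour) → ListAssignment n k → Set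
c FromLists L = ∀ v → c v ∈ˡ ListAssignment.list L v

Adapted : (G : Graph n) → EdgeColouring G → (Fin n → Colour) → Set
Adapted G F c = ∀ d → ¬ (c (src d) ≡ colour d × c (tgt d) ≡ colour d)
  where open Dart; open EdgeColouring F

Proper : Graph n → (Fin n → Colour) → Set
Proper G c = ∀ {u v} → u ~ v → c u ≢ c v
  where open Graph G

AdaptablyChoosable : ℕ → Graph n → Set
AdaptablyChoosable k G =
  (F : EdgeColouring G) (L : ListAssignment _ k) →
  ∃ λ c → Adapted G F c × c FromLists L

commonColours : List Colour → List Colour → ℕ
commonColours xs ys = length (filter (_∈ℤ? ys) xs)

Choosable : ℕ → ℕ → Graph n → Set
Choosable k d G =
  (L : ListAssignment _ k) (let open ListAssignment L) →
  (∀ {u v} → u ~ v → commonColours (list u) (list v) ≤ d) →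
  ∃ λ c → Proper G c × c FromLists L
  where open Graph G

{-# OPTIONS --safe #-}
module Submission where

-- Let H be a subgraph of G with e edges and v ≥ 1 vertices.  Instead of
-- embedding H, glue the faces of G across the edges outside H.  Each gluing
-- loses at most one face, and those across a spanning forest of the vertices
-- outside H are free, so Euler's formula for G bounds e by v plus the number of
-- glued faces, minus 2 when G is connected.  The boundary of a glued face, if it
-- has at most five edges, is empty or a cycle.  Give a glued face with ℓ
-- boundary edges the charge ℓ − 4, and let every triangle take 1/3 across each
-- of its edges.  Neighbours of a triangle have ℓ ≥ 5 (unless two faces share
-- the same triangle and exhaust their component), a 5-cycle pays at most three
-- times and a longer boundary can afford ℓ/3; so the total charge is at least
-- −4 per component, which gives e < 2v.
--
-- A graph all of whose subgraphs satisfy e < 2v has an orientation with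
-- out-degrees at most 2: reverse directed paths from overloaded vertices to
-- vertices of out-degree at most 1; if none can be reached, the reachable
-- vertices span too many edges.  Every vertex then avoids the at most two
-- colours that its outgoing edges forbid.

-- Deleting edges from a rotation system would mean rebuilding the permutation on fewer darts and
-- proving that the genus does not grow. Under gluing the darts and the rotation of `G` stay fixed
-- and only the face classes become coarser; `cls-rot` is the one link between rotation and classes
-- that the boundary arguments use. Boundary cycles are thus cycles of `G` itself, where the
-- hypotheses apply. The constants: for connected `G` with an edge, Euler's formula becomes e + 2 ≤
-- v + F for F glued faces. A total charge of at least -4 says 4F ≤ 2e + 4, and together these give
-- e + 2 ≤ 2v. The value -4 is the charge of a class with empty boundary, which is then the only
-- class of its component. A triangle lacks charge 1, hence a third per edge; a 5-cycle has 1 to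
-- spare, which is three thirds; and ℓ - 4 ≥ ℓ/3 holds exactly from ℓ = 6 on, so the shape of longer
-- boundaries is irrelevant.

open import Data.Bool as Bool using (Bool; T; T?; if_then_else_)
import Data.Bool.Properties as Bool
open import Data.Empty using (⊥; ⊥-elim)
open import Data.Fin as Fin using (Fin; zero; suc; toℕ; fromℕ<; punchIn; punchOut)
import Data.Fin.Properties as Fin
open import Data.Fin.Subset as Subset using (Subset; ∣_∣)
import Data.Fin.Subset.Properties as Subset
import Data.Integer as ℤ
import Data.Integer.Properties as ℤ
open import Data.List as List using (List; []; _∷_; [_]; _++_; length; lookup; map; filter; concatMap; allFin; applyUpTo; cartesianProduct; cartesianProductWith)
import Data.List.Membership.DecPropositional as DecMembership
open import Data.List.Membership.Propositional using (_∈_; _∉_; find; lose)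
open import Data.List.Membership.Propositional.Properties using (∈-∃++; ∈-++⁺ˡ; ∈-++⁺ʳ; ∈-++⁻; ∈-allFin; ∈-applyUpTo⁺; ∈-applyUpTo⁻; ∈-cartesianProduct⁺; ∈-concatMap⁺; ∈-filter⁺; ∈-filter⁻; ∈-lookup; ∈-map⁺)
import Data.List.Properties as List
open import Data.List.Relation.Unary.All as All using (All; []; _∷_)
import Data.List.Relation.Unary.All.Properties as All
open import Data.List.Relation.Unary.AllPairs using ([]; _∷_)
open import Data.List.Relation.Unary.Any using (any?; here; there)
open import Data.List.Relation.Unary.Unique.Propositional using (Unique)
open import Data.List.Relation.Unary.Unique.Propositional.Properties using (allFin⁺; applyUpTo⁺₁; cartesianProduct⁺; filter⁺; map⁺; map⁻; ++⁺)
open import Data.Nat as ℕ using (ℕ; zero; suc; _+_; _*_; _≤_; _≤?_; _%_; z≤n; s≤s; s≤s⁻¹)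
open import Data.Nat.DivMod using (m<n⇒m%n≡m; n%n≡0; m%n<n)
open import Data.Nat.Properties
open import Algebra.Properties.CommutativeSemigroup +-commutativeSemigroup using (interchange; x∙yz≈y∙xz)
open import Data.Nat.Solver using (module +-*-Solver)
open import Data.Product using (∃; Σ; _×_; _,_; proj₁; proj₂)
open import Data.Rational as ℚ using (_<_; _/_)
import Data.Rational.Properties as ℚ
import Data.Rational.Unnormalised as ℚᵘ
import Data.Rational.Unnormalised.Properties as ℚᵘ
open import Data.Sum as Sum using (_⊎_; inj₁; inj₂)
open import Data.Vec as Vec using ([]; _∷_; tabulate)
import Data.Vec.Properties as Vec
open import Function using (_∘_; id; module Equivalence; module Inverse)
open import Relation.Binary using (DecidableEquality; DecTotalOrder; tri<; tri≈; tri>)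
open import Relation.Binary.Construct.Closure.ReflexiveTransitive using (Star; ε; _◅_)
open import Relation.Binary.PropositionalEquality using (_≡_; _≢_; refl; sym; trans; cong; cong₂; subst; subst₂; module ≡-Reasoning)
open import Relation.Nullary using (Dec; yes; no; does; ¬_; ¬?; contradiction)
open import Relation.Nullary.Decidable using (_×-dec_; _⊎-dec_; decidable-stable; map′; from-yes; toWitness; dec-true)
open import Relation.Unary using (Pred; Decidable)
open import Data.List.Extrema (DecTotalOrder.totalOrder ℚ.≤-decTotalOrder) using (max<v⁺)
open import Defs

private variable
  A B : Set
  P Q : Set
  k m n : ℕ

-- Finite sums

∑ : List A → (A → ℕ) → ℕ
∑ []       f = 0
∑ (x ∷ xs) f = f x + ∑ xs f

⟦_⟧ : Dec P → ℕ
⟦ p ⟧ = if does p then 1 else 0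

⟦⟧≤1 : (p : Dec P) → ⟦ p ⟧ ≤ 1
⟦⟧≤1 (yes _) = ≤-refl
⟦⟧≤1 (no _)  = z≤n

⟦⟧-yes : (p : Dec P) → P → ⟦ p ⟧ ≡ 1
⟦⟧-yes (yes _) _ = refl
⟦⟧-yes (no ¬x) x = contradiction x ¬x

⟦⟧-no : (p : Dec P) → ¬ P → ⟦ p ⟧ ≡ 0
⟦⟧-no (yes x) ¬x = contradiction x ¬x
⟦⟧-no (no _)  _  = refl

⟦⟧-mono : (p : Dec P) (q : Dec Q) → (P → Q) → ⟦ p ⟧ ≤ ⟦ q ⟧
⟦⟧-mono (no _)  q f = z≤n
⟦⟧-mono (yes x) q f = ≤-reflexive (sym (⟦⟧-yes q (f x)))

⟦⟧-cong : (p : Dec P) (q : Dec Q) → (P → Q) → (Q → P) → ⟦ p ⟧ ≡ ⟦ q ⟧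
⟦⟧-cong p q f g = ≤-antisym (⟦⟧-mono p q f) (⟦⟧-mono q p g)

⟦⟧-× : (p : Dec P) (q : Dec Q) → ⟦ p ×-dec q ⟧ ≡ ⟦ p ⟧ * ⟦ q ⟧
⟦⟧-× (yes _) q = sym (*-identityˡ _)
⟦⟧-× (no _)  q = refl

⟦⟧*≢0⇒ : (p : Dec P) {m : ℕ} → ⟦ p ⟧ * m ≢ 0 → P
⟦⟧*≢0⇒ (yes x) _ = x
⟦⟧*≢0⇒ (no _)  h = contradiction refl h

⟦⟧*≤ : (p : Dec P) (m : ℕ) → ⟦ p ⟧ * m ≤ m
⟦⟧*≤ p m = ≤-trans (*-monoˡ-≤ m (⟦⟧≤1 p)) (≤-reflexive (*-identityˡ m))

⟦⟧≢0⇒ : (p : Dec P) → ⟦ p ⟧ ≢ 0 → P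
⟦⟧≢0⇒ (yes x) _ = x
⟦⟧≢0⇒ (no _)  h = contradiction refl h

∑-mono∈ : (xs : List A) {f g : A → ℕ} → (∀ {x} → x ∈ xs → f x ≤ g x) → ∑ xs f ≤ ∑ xs g
∑-mono∈ []       h = z≤n
∑-mono∈ (x ∷ xs) h = +-mono-≤ (h (here refl)) (∑-mono∈ xs (h ∘ there))

∑-mono : (xs : List A) {f g : A → ℕ} → (∀ x → f x ≤ g x) → ∑ xs f ≤ ∑ xs g
∑-mono xs h = ∑-mono∈ xs λ {x} _ → h x

∑-cong : (xs : List A) {f g : A → ℕ} → (∀ x → f x ≡ g x) → ∑ xs f ≡ ∑ xs g
∑-cong []       h = refl
∑-cong (x ∷ xs) h = cong₂ _+_ (h x) (∑-cong xs h)

∑-+ : (xs : List A) (f g : A → ℕ) → ∑ xs (λ x → f x + g x) ≡ ∑ xs f + ∑ xs g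
∑-+ []       f g = refl
∑-+ (x ∷ xs) f g =
  trans (cong (f x + g x +_) (∑-+ xs f g)) (interchange (f x) (g x) (∑ xs f) (∑ xs g))

∑-* : (xs : List A) (m : ℕ) (f : A → ℕ) → ∑ xs (λ x → m * f x) ≡ m * ∑ xs f
∑-* []       m f = sym (*-zeroʳ m)
∑-* (x ∷ xs) m f = trans (cong (m * f x +_) (∑-* xs m f)) (sym (*-distribˡ-+ m (f x) (∑ xs f)))

∑-const : (xs : List A) (m : ℕ) → ∑ xs (λ _ → m) ≡ length xs * m
∑-const []       m = refl
∑-const (x ∷ xs) m = cong (m +_) (∑-const xs m)

∑-swap : (xs : List A) (ys : List B) (f : A → B → ℕ) →
         ∑ xs (λ x → ∑ ys (f x)) ≡ ∑ ys (λ y → ∑ xs (λ x → f x y))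
∑-swap []       ys f = sym (trans (∑-const ys 0) (*-zeroʳ (length ys)))
∑-swap (x ∷ xs) ys f =
  trans (cong (∑ ys (f x) +_) (∑-swap xs ys f)) (sym (∑-+ ys (f x) λ y → ∑ xs (λ x → f x y)))

∑-++ : (xs ys : List A) (f : A → ℕ) → ∑ (xs ++ ys) f ≡ ∑ xs f + ∑ ys f
∑-++ []       ys f = refl
∑-++ (x ∷ xs) ys f = trans (cong (f x +_) (∑-++ xs ys f)) (sym (+-assoc (f x) _ _))

∑-map : (h : A → B) (xs : List A) (f : B → ℕ) → ∑ (map h xs) f ≡ ∑ xs (f ∘ h)
∑-map h []       f = refl
∑-map h (x ∷ xs) f = cong (f (h x) +_) (∑-map h xs f)

∑-concatMap : (h : A → List B) (xs : List A) (f : B → ℕ) →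
              ∑ (concatMap h xs) f ≡ ∑ xs (λ x → ∑ (h x) f)
∑-concatMap h []       f = refl
∑-concatMap h (x ∷ xs) f =
  trans (∑-++ (h x) (concatMap h xs) f) (cong (∑ (h x) f +_) (∑-concatMap h xs f))

length-filter≡∑ : {P : Pred A _} (P? : Decidable P) (xs : List A) →
                  length (filter P? xs) ≡ ∑ xs (λ x → ⟦ P? x ⟧)
length-filter≡∑ P? []       = refl
length-filter≡∑ P? (x ∷ xs) with P? x
... | yes _ = cong suc (length-filter≡∑ P? xs)
... | no _  = length-filter≡∑ P? xs

-- Each entry of `xs` with a nonzero value uses up an occurrence in `ys`, and leftover entries of
-- `ys` only add. Most upper bounds below list the few places where a summand can be nonzero;
-- `ys = []` shows that a sum vanishes.
∑-cover : {xs ys : List A} (f : A → ℕ) → Unique xs →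
          (∀ {x} → x ∈ xs → f x ≢ 0 → x ∈ ys) → ∑ xs f ≤ ∑ ys f
∑-cover {xs = []}     f _          _ = z≤n
∑-cover {xs = x ∷ xs} f (x∉ ∷ uxs) h with f x ≟ 0
... | yes fx≡0 rewrite fx≡0 = ∑-cover f uxs (h ∘ there)
... | no fx≢0 with as , bs , refl ← ∈-∃++ (h (here refl) fx≢0) = begin
  f x + ∑ xs f               ≤⟨ +-monoʳ-≤ (f x) (∑-cover f uxs h′) ⟩
  f x + ∑ (as ++ bs) f       ≡⟨ cong (f x +_) (∑-++ as bs f) ⟩
  f x + (∑ as f + ∑ bs f)    ≡⟨ x∙yz≈y∙xz (f x) (∑ as f) (∑ bs f) ⟩
  ∑ as f + (f x + ∑ bs f)    ≡⟨ ∑-++ as (x ∷ bs) f ⟨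
  ∑ (as ++ x ∷ bs) f         ∎
  where
  open ≤-Reasoning
  h′ : ∀ {y} → y ∈ xs → f y ≢ 0 → y ∈ as ++ bs
  h′ y∈ fy≢0 with ∈-++⁻ as (h (there y∈) fy≢0)
  ... | inj₁ y∈as         = ∈-++⁺ˡ y∈as
  ... | inj₂ (here y≡x)   = contradiction (sym y≡x) (All.lookup x∉ y∈)
  ... | inj₂ (there y∈bs) = ∈-++⁺ʳ as y∈bs

length≤∑ : {xs ys : List A} (f : A → ℕ) → Unique ys →
           (∀ {y} → y ∈ ys → y ∈ xs) → (∀ {y} → y ∈ ys → 1 ≤ f y) → length ys ≤ ∑ xs f
length≤∑ {xs = xs} {ys} f uys ys⊆xs pos = begin
  length ys         ≡⟨ *-identityʳ _ ⟨
  length ys * 1     ≡⟨ ∑-const ys 1 ⟨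
  ∑ ys (λ _ → 1)    ≤⟨ ∑-mono∈ ys pos ⟩
  ∑ ys f            ≤⟨ ∑-cover f uys (λ y∈ _ → ys⊆xs y∈) ⟩
  ∑ xs f            ∎
  where open ≤-Reasoning

unique-length : {xs ys : List A} → Unique ys → (∀ {y} → y ∈ ys → y ∈ xs) → length ys ≤ length xs
unique-length {xs = xs} uys ys⊆xs =
  ≤-trans (length≤∑ (λ _ → 1) uys ys⊆xs (λ _ → ≤-refl))
          (≤-reflexive (trans (∑-const xs 1) (*-identityʳ _)))

∈⇒≤∑ : {xs : List A} {x : A} (f : A → ℕ) → x ∈ xs → f x ≤ ∑ xs f
∈⇒≤∑ f (here refl) = m≤m+n _ _
∈⇒≤∑ f (there x∈)  = m≤n⇒m≤o+n _ (∈⇒≤∑ f x∈)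

module _ (_≟_ : DecidableEquality A) where

  ∑-≟ : {xs : List A} → Unique xs → ∀ {x} → x ∈ xs → ∑ xs (λ y → ⟦ x ≟ y ⟧) ≡ 1
  ∑-≟ {xs} uniq {x} x∈ = ≤-antisym
    (≤-trans (∑-cover {ys = [ x ]} _ uniq (λ {y} _ h → here (sym (⟦⟧≢0⇒ (x ≟ y) h))))
             (≤-reflexive (trans (+-identityʳ _) at)))
    (≤-trans (≤-reflexive (sym at)) (∈⇒≤∑ _ x∈))
    where
    at : ⟦ x ≟ x ⟧ ≡ 1
    at = ⟦⟧-yes (x ≟ x) refl

∑-allFin-≟ : (i : Fin n) → ∑ (allFin n) (λ j → ⟦ i Fin.≟ j ⟧) ≡ 1
∑-allFin-≟ {n} i = ∑-≟ Fin._≟_ (allFin⁺ n) (∈-allFin i)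

∑-allFin-const : ∀ n m → ∑ (allFin n) (λ _ → m) ≡ n * m
∑-allFin-const n m = trans (∑-const (allFin n) m) (cong (_* m) (List.length-tabulate {n = n} id))

∑-fibres : (h : A → Fin k) (xs : List A) (f : A → ℕ) →
           ∑ xs f ≡ ∑ (allFin k) (λ j → ∑ xs (λ x → ⟦ h x Fin.≟ j ⟧ * f x))
∑-fibres {k = k} h xs f = sym (begin
  ∑ (allFin k) (λ j → ∑ xs (λ x → ⟦ h x Fin.≟ j ⟧ * f x))
    ≡⟨ ∑-swap (allFin k) xs _ ⟩
  ∑ xs (λ x → ∑ (allFin k) (λ j → ⟦ h x Fin.≟ j ⟧ * f x))
    ≡⟨ ∑-cong xs (λ x → ∑-cong (allFin k) (λ j → *-comm ⟦ h x Fin.≟ j ⟧ (f x))) ⟩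
  ∑ xs (λ x → ∑ (allFin k) (λ j → f x * ⟦ h x Fin.≟ j ⟧))
    ≡⟨ ∑-cong xs (λ x → trans (∑-* (allFin k) (f x) _)
         (trans (cong (f x *_) (∑-allFin-≟ (h x))) (*-identityʳ (f x)))) ⟩
  ∑ xs f ∎)
  where open ≡-Reasoning

-- Search trees in a digraph on Fin n

record SearchForest {n} (E : Fin n → Fin n → Set) (R : Fin n → Set) : Set₁ where
  field
    X      : Fin n → Set
    X?     : Decidable X
    rank   : Fin n → ℕ
    height : ℕ
    par    : Fin n → Fin n
    root   : ∀ {v} → R v → X v
    low    : ∀ {v} → X v → rank v ℕ.< height
    parent : ∀ {v} → X v → ¬ R v → X (par v) × E (par v) v × rank (par v) ℕ.< rank v

module _ {n} {E : Fin n → Fin n → Set} (E? : ∀ u v → Dec (E u v))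
         {R : Fin n → Set} (R? : Decidable R) where

  open SearchForest

  Closed : SearchForest E R → Set
  Closed S = ∀ {u v} → X S u → E u v → X S v

  private
    unreached : SearchForest E R → ℕ
    unreached S = ∑ (allFin n) (λ v → ⟦ ¬? (X? S v) ⟧)

    extend : (S : SearchForest E R) {u y : Fin n} → X S u → E u y → ¬ X S y →
             ∃ λ S′ → suc (unreached S′) ≤ unreached S
    extend S {u} {y} Xu Euy ¬Xy = S′ , smaller
      where
      rank′ : Fin n → ℕ
      rank′ v with v Fin.≟ y
      ... | yes _ = height S
      ... | no _  = rank S v

      par′ : Fin n → Fin n
      par′ v with v Fin.≟ y
      ... | yes _ = u
      ... | no _  = par S v

      rank-old : ∀ {v} → X S v → rank′ v ≡ rank S v
      rank-old {v} Xv with v Fin.≟ y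
      ... | yes refl = contradiction Xv ¬Xy
      ... | no _     = refl

      low′ : ∀ {v} → X S v ⊎ v ≡ y → rank′ v ℕ.< suc (height S)
      low′ {v} Xv with v Fin.≟ y | Xv
      ... | yes _ | _        = ≤-refl
      ... | no _  | inj₁ Xv  = m<n⇒m<1+n (low S Xv)
      ... | no ne | inj₂ v≡y = contradiction v≡y ne

      parent′ : ∀ {v} → X S v ⊎ v ≡ y → ¬ R v →
                (X S (par′ v) ⊎ par′ v ≡ y) × E (par′ v) v × rank′ (par′ v) ℕ.< rank′ v
      parent′ {v} Xv ¬Rv with v Fin.≟ y | Xv
      ... | yes refl | _        = inj₁ Xu , Euy , subst (ℕ._< height S) (sym (rank-old Xu)) (low S Xu)
      ... | no ne    | inj₂ v≡y = contradiction v≡y ne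
      ... | no ne    | inj₁ Xv  with Xp , Epv , lt ← parent S Xv ¬Rv =
        inj₁ Xp , Epv , subst (ℕ._< rank S v) (sym (rank-old Xp)) lt

      S′ : SearchForest E R
      S′ = record
        { X = λ v → X S v ⊎ v ≡ y ; X? = λ v → X? S v ⊎-dec v Fin.≟ y
        ; rank = rank′ ; height = suc (height S) ; par = par′
        ; root = inj₁ ∘ root S ; low = low′ ; parent = parent′ }

      pointwise : ∀ v → ⟦ y Fin.≟ v ⟧ + ⟦ ¬? (X? S′ v) ⟧ ≤ ⟦ ¬? (X? S v) ⟧
      pointwise v with y Fin.≟ v
      ... | yes refl
        rewrite ⟦⟧-no (¬? (X? S′ y)) (λ ¬X → ¬X (inj₂ refl)) =
          ≤-reflexive (sym (⟦⟧-yes (¬? (X? S y)) ¬Xy))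
      ... | no _ = ⟦⟧-mono (¬? (X? S′ v)) (¬? (X? S v)) (λ ¬X → ¬X ∘ inj₁)

      smaller : suc (unreached S′) ≤ unreached S
      smaller = begin
        1 + unreached S′
          ≡⟨ cong (_+ unreached S′) (∑-allFin-≟ y) ⟨
        ∑ (allFin n) (λ v → ⟦ y Fin.≟ v ⟧) + unreached S′
          ≡⟨ ∑-+ (allFin n) _ _ ⟨
        ∑ (allFin n) (λ v → ⟦ y Fin.≟ v ⟧ + ⟦ ¬? (X? S′ v) ⟧)
          ≤⟨ ∑-mono (allFin n) pointwise ⟩
        unreached S ∎
        where open ≤-Reasoning

    grow : (S : SearchForest E R) (fuel : ℕ) → unreached S ≤ fuel → ∃ Closed
    grow S fuel le
      with Fin.any? (λ u → Fin.any? (λ v → X? S u ×-dec E? u v ×-dec ¬? (X? S v)))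
    ... | no none = S , λ {u} {v} Xu Euv →
      decidable-stable (X? S v) (λ ¬Xv → none (u , v , Xu , Euv , ¬Xv))
    ... | yes (u , v , Xu , Euv , ¬Xv) with extend S Xu Euv ¬Xv | fuel
    ... | S′ , lt | zero    = contradiction (≤-trans lt le) λ ()
    ... | S′ , lt | suc fuel′ = grow S′ fuel′ (s≤s⁻¹ (≤-trans lt le))

  closedForest : ∃ Closed
  closedForest = grow start _ ≤-refl
    where
    start : SearchForest E R
    start = record
      { X = R ; X? = R? ; rank = λ _ → 0 ; height = 1 ; par = id
      ; root = id ; low = λ _ → ≤-refl ; parent = λ Rv ¬Rv → contradiction Rv ¬Rv }

-- Gluing

private
  -- The index `p` is removed and redirected to the new index of `q`.
  glue : (p q : Fin (suc k)) → p ≢ q → Fin (suc k) → Fin k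
  glue p q p≢q x with p Fin.≟ x
  ... | yes _  = punchOut p≢q
  ... | no p≢x = punchOut p≢x

  glue-≡ : (p q : Fin (suc k)) (p≢q : p ≢ q) → glue p q p≢q p ≡ glue p q p≢q q
  glue-≡ p q p≢q with p Fin.≟ p | p Fin.≟ q
  ... | yes _  | no _    = Fin.punchOut-cong p refl
  ... | _      | yes p≡q = contradiction p≡q p≢q
  ... | no p≢p | _       = contradiction refl p≢p

  glue-punchIn : (p q : Fin (suc k)) (p≢q : p ≢ q) (y : Fin k) → glue p q p≢q (punchIn p y) ≡ y
  glue-punchIn p q p≢q y with p Fin.≟ punchIn p y
  ... | yes eq = contradiction (sym eq) (Fin.punchInᵢ≢i p y)
  ... | no _   = trans (Fin.punchOut-cong p refl) (Fin.punchOut-punchIn p)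

-- Pairs are merged one at a time, as in union-find, and `bound` charges one class for each pair
-- even if it was merged already. `onto` keeps every class inhabited by a dart, so that it can later
-- be assigned to a component.
record Gluing (cls : A → Fin k) (ps : List (A × A)) : Set where
  field
    size    : ℕ
    cls′    : A → Fin size
    onto    : ∀ j → ∃ λ x → cls′ x ≡ j
    coarser : ∀ {x y} → cls x ≡ cls y → cls′ x ≡ cls′ y
    glued   : ∀ {x y} → (x , y) ∈ ps → cls′ x ≡ cls′ y
    bound   : k ≤ size + length ps

glueing : (cls : A → Fin k) → (∀ j → ∃ λ x → cls x ≡ j) → ∀ ps → Gluing cls ps
glueing {k = k} cls onto [] = record
  { size = k ; cls′ = cls ; onto = onto ; coarser = id ; glued = λ () ; bound = m≤m+n k 0 }
glueing cls onto ((a , b) ∷ ps) with glueing cls onto ps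
... | record { size = size ; cls′ = c ; onto = o ; coarser = co ; glued = gl ; bound = bd }
  with c a Fin.≟ c b
... | yes eq = record
  { size = size ; cls′ = c ; onto = o ; coarser = co
  ; glued = λ { (here refl) → eq ; (there p) → gl p }
  ; bound = ≤-trans bd (+-monoʳ-≤ size (n≤1+n _)) }
... | no ne with size
... | zero  = contradiction (c a) λ ()
... | suc m = record
  { size = m ; cls′ = λ x → g (c x)
  ; onto = λ j → let x , eq = o (punchIn (c a) j) in
                 x , trans (cong g eq) (glue-punchIn (c a) (c b) ne j)
  ; coarser = λ eq → cong g (co eq)
  ; glued = λ { (here refl) → glue-≡ (c a) (c b) ne ; (there p) → cong g (gl p) }
  ; bound = ≤-trans bd (≤-reflexive (sym (+-suc m _))) }
  where
  g : Fin (suc m) → Fin m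
  g = glue (c a) (c b) ne

-- Darts

∣∣≡∑ : (p : Subset n) → ∣ p ∣ ≡ ∑ (allFin n) (λ v → ⟦ v Subset.∈? p ⟧)
∣∣≡∑ []      = refl
∣∣≡∑ {suc n} (x ∷ p) = trans (step x) (cong (⟦ zero Subset.∈? (x ∷ p) ⟧ +_) (trans (∣∣≡∑ p) (sym shift)))
  where
  step : ∀ x → ∣ x ∷ p ∣ ≡ ⟦ zero Subset.∈? (x ∷ p) ⟧ + ∣ p ∣
  step Bool.true  = refl
  step Bool.false = refl
  shift : ∑ (List.tabulate Fin.suc) (λ v → ⟦ v Subset.∈? (x ∷ p) ⟧) ≡ ∑ (allFin n) (λ v → ⟦ v Subset.∈? p ⟧)
  shift = trans (cong (λ vs → ∑ vs (λ v → ⟦ v Subset.∈? (x ∷ p) ⟧)) (sym (List.map-tabulate id Fin.suc)))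
         (trans (∑-map Fin.suc (allFin n) (λ v → ⟦ v Subset.∈? (x ∷ p) ⟧))
                (∑-cong (allFin n) (λ v → ⟦⟧-cong (suc v Subset.∈? (x ∷ p)) (v Subset.∈? p) Subset.drop-there Vec.there)))

module Darts {n} (G : Graph n) where

  open Graph G using (adj; _~_)
  open Dart public

  dart-≡ : {d e : Dart G} → src d ≡ src e → tgt d ≡ tgt e → d ≡ e
  dart-≡ {dart u v p} {dart .u .v q} refl refl = cong (dart u v) (Bool.T-irrelevant p q)

  _≟ᵈ_ : DecidableEquality (Dart G)
  d ≟ᵈ e = map′ (λ (p , q) → dart-≡ p q) (λ { refl → refl , refl })
                (src d Fin.≟ src e ×-dec tgt d Fin.≟ tgt e)

  rev-rev : (d : Dart G) → rev (rev d) ≡ d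
  rev-rev d = dart-≡ refl refl

  src≢tgt : (d : Dart G) → src d ≢ tgt d
  src≢tgt (dart u .u e) refl = Graph.irrefl G e

  pairs : List (Fin n × Fin n)
  pairs = cartesianProduct (allFin n) (allFin n)

  dartsOn : ∀ {u v} → Dec (u ~ v) → List (Dart G)
  dartsOn (yes e) = [ dart _ _ e ]
  dartsOn (no _)  = []

  darts : List (Dart G)
  darts = concatMap (λ (u , v) → dartsOn (T? (adj u v))) pairs

  ∈-darts : (d : Dart G) → d ∈ darts
  ∈-darts (dart u v e) = ∈-concatMap⁺ (λ (u , v) → dartsOn (T? (adj u v)))
    (lose (∈-cartesianProduct⁺ (∈-allFin u) (∈-allFin v)) (on (T? (adj u v))))
    where
    on : (e? : Dec (u ~ v)) → dart u v e ∈ dartsOn e?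
    on (yes e′) = here (dart-≡ refl refl)
    on (no ¬e)  = contradiction e ¬e

  darts-unique : Unique darts
  darts-unique = map⁻ (subst Unique (sym (ends pairs)) (filter⁺ Q? (cartesianProduct⁺ (allFin⁺ n) (allFin⁺ n))))
    where
    Q? : Decidable (λ (u , v) → u ~ v)
    Q? (u , v) = T? (adj u v)
    ends : ∀ ps → map (λ d → src d , tgt d) (concatMap (λ (u , v) → dartsOn (T? (adj u v))) ps) ≡ filter Q? ps
    ends [] = refl
    ends ((u , v) ∷ ps) with T? (adj u v)
    ... | yes e = trans (cong (_ ∷_) (ends ps)) (sym (List.filter-accept Q? e))
    ... | no ¬e = trans (ends ps) (sym (List.filter-reject Q? ¬e))

  ∑-rev : (f : Dart G → ℕ) → ∑ darts (f ∘ rev) ≡ ∑ darts f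
  ∑-rev f = ≤-antisym (half f) (≤-trans (≤-reflexive (∑-cong darts (λ d → cong f (sym (rev-rev d))))) (half (f ∘ rev)))
    where
    rev-injective : ∀ {d e} → rev d ≡ rev e → d ≡ e
    rev-injective {d} {e} eq = trans (sym (rev-rev d)) (trans (cong rev eq) (rev-rev e))
    half : ∀ g → ∑ darts (g ∘ rev) ≤ ∑ darts g
    half g = ≤-trans (≤-reflexive (sym (∑-map rev darts g)))
                     (∑-cover g (map⁺ rev-injective darts-unique) (λ {x} _ _ → ∈-darts x))

  up : Dart G → ℕ
  up d = ⟦ src d Fin.<? tgt d ⟧

  up+up : ∀ d → up d + up (rev d) ≡ 1
  up+up d with Fin.<-cmp (src d) (tgt d)
  ... | tri< lt _ ¬gt = cong₂ _+_ (⟦⟧-yes (src d Fin.<? tgt d) lt) (⟦⟧-no (tgt d Fin.<? src d) ¬gt)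
  ... | tri> ¬lt _ gt = cong₂ _+_ (⟦⟧-no (src d Fin.<? tgt d) ¬lt) (⟦⟧-yes (tgt d Fin.<? src d) gt)
  ... | tri≈ _ eq _   = contradiction eq (src≢tgt d)

  -- Exactly one dart of each edge has `up` equal to 1, so the left side is a sum over edges of the
  -- values on both orientations. This is the passage between counting edges and counting darts.
  ∑-up : (f : Dart G → ℕ) → ∑ darts (λ d → up d * (f d + f (rev d))) ≡ ∑ darts f
  ∑-up f = begin
    ∑ darts (λ d → up d * (f d + f (rev d)))
      ≡⟨ ∑-cong darts (λ d → *-distribˡ-+ (up d) (f d) (f (rev d))) ⟩
    ∑ darts (λ d → up d * f d + up d * f (rev d))
      ≡⟨ ∑-+ darts _ _ ⟩
    ∑ darts (λ d → up d * f d) + ∑ darts (λ d → up d * f (rev d))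
      ≡⟨ cong (∑ darts (λ d → up d * f d) +_) (∑-rev (λ d → up d * f (rev d))) ⟨
    ∑ darts (λ d → up d * f d) + ∑ darts (λ d → up (rev d) * f (rev (rev d)))
      ≡⟨ ∑-+ darts _ _ ⟨
    ∑ darts (λ d → up d * f d + up (rev d) * f (rev (rev d)))
      ≡⟨ ∑-cong darts (λ d → trans (cong (λ e → up d * f d + up (rev d) * f e) (rev-rev d))
           (trans (sym (*-distribʳ-+ (f d) (up d) (up (rev d)))) (trans (cong (_* f d) (up+up d)) (*-identityˡ (f d))))) ⟩
    ∑ darts f ∎
    where open ≡-Reasoning

  edgeCount≡∑ : (a : Fin n → Fin n → Bool) → (∀ u v → T (a u v) → u ~ v) →
                edgeCount a ≡ ∑ darts (λ d → up d * ⟦ T? (a (src d) (tgt d)) ⟧)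
  edgeCount≡∑ a a⊆ = begin
    edgeCount a
      ≡⟨ length-filter≡∑ (λ (u , v) → u Fin.<? v ×-dec T? (a u v)) pairs ⟩
    ∑ pairs (λ (u , v) → ⟦ u Fin.<? v ×-dec T? (a u v) ⟧)
      ≡⟨ ∑-cong pairs (λ (u , v) → step u v (T? (adj u v))) ⟩
    ∑ pairs (λ (u , v) → ∑ (dartsOn (T? (adj u v))) f)
      ≡⟨ ∑-concatMap _ pairs f ⟨
    ∑ darts f ∎
    where
    open ≡-Reasoning
    f : Dart G → ℕ
    f d = up d * ⟦ T? (a (src d) (tgt d)) ⟧
    step : ∀ u v (e? : Dec (u ~ v)) → ⟦ u Fin.<? v ×-dec T? (a u v) ⟧ ≡ ∑ (dartsOn e?) f
    step u v (yes e) = trans (⟦⟧-× (u Fin.<? v) (T? (a u v))) (sym (+-identityʳ _))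
    step u v (no ¬e) = ⟦⟧-no (u Fin.<? v ×-dec T? (a u v)) (λ (_ , t) → ¬e (a⊆ u v t))

  2*edgeCount≡∑ : (a : Fin n → Fin n → Bool) → (∀ u v → T (a u v) → T (a v u)) → (∀ u v → T (a u v) → u ~ v) →
                  2 * edgeCount a ≡ ∑ darts (λ d → ⟦ T? (a (src d) (tgt d)) ⟧)
  2*edgeCount≡∑ a a-sym a⊆ = begin
    2 * edgeCount a                                ≡⟨ cong (2 *_) (edgeCount≡∑ a a⊆) ⟩
    2 * ∑ darts (λ d → up d * f d)                 ≡⟨ ∑-* darts 2 _ ⟨
    ∑ darts (λ d → 2 * (up d * f d))               ≡⟨ ∑-cong darts double ⟩
    ∑ darts (λ d → up d * (f d + f (rev d)))       ≡⟨ ∑-up f ⟩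
    ∑ darts f                                      ∎
    where
    open ≡-Reasoning
    f : Dart G → ℕ
    f d = ⟦ T? (a (src d) (tgt d)) ⟧
    double : ∀ d → 2 * (up d * f d) ≡ up d * (f d + f (rev d))
    double d = begin
      2 * (up d * f d)           ≡⟨ cong (up d * f d +_) (+-identityʳ _) ⟩
      up d * f d + up d * f d    ≡⟨ *-distribˡ-+ (up d) (f d) (f d) ⟨
      up d * (f d + f d)         ≡⟨ cong (λ m → up d * (f d + m)) (⟦⟧-cong (T? (a (src d) (tgt d))) (T? (a (tgt d) (src d))) (a-sym _ _) (a-sym _ _)) ⟩
      up d * (f d + f (rev d))   ∎

-- Boundaries of classes of darts

toℕ-next : (i : Fin m) → toℕ (next i) ≡ suc (toℕ i) ⊎ (suc (toℕ i) ≡ m × toℕ (next i) ≡ 0)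
toℕ-next {suc m} i with suc (toℕ i) ≟ suc m
... | yes eq = inj₂ (eq , trans (Fin.toℕ-fromℕ< (m%n<n (suc (toℕ i)) (suc m)))
                                (trans (cong (_% suc m) eq) (n%n≡0 (suc m))))
... | no ne  = inj₁ (trans (Fin.toℕ-fromℕ< (m%n<n (suc (toℕ i)) (suc m)))
                           (m<n⇒m%n≡m (≤∧≢⇒< (Fin.toℕ<n i) ne)))

module Boundary {n} {G : Graph n} (rot : Rotation G) {F : ℕ} (cls : Dart G → Fin F)
                (cls-rot : ∀ d → cls (Inverse.to (Rotation.perm rot) d) ≡ cls (rev d)) where

  open Darts G

  π : Dart G → Dart G
  π = Inverse.to (Rotation.perm rot)

  π-injective : ∀ {d e} → π d ≡ π e → d ≡ e
  π-injective {d} {e} eq = trans (sym (inv d)) (trans (cong (Inverse.from (Rotation.perm rot)) eq) (inv e))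
    where inv = Inverse.strictlyInverseʳ (Rotation.perm rot)

  -- Faces around a vertex are consecutive, so a set of classes that is not left
  -- by crossing an edge contains all classes at a vertex or none.
  spread : (X : Fin F → Set) → (∀ d → X (cls d) → X (cls (rev d))) →
           ∀ {d e} → Star (Graph._~_ G) (src d) (src e) → X (cls d) → X (cls e)
  spread X flip {d} = go refl
    where
    around : ∀ {d e} → Orbit π d e → X (cls d) → X (cls e)
    around ε          x = x
    around (refl ◅ p) x = around p (subst X (sym (cls-rot _)) (flip _ x))

    go : ∀ {d e u} → src d ≡ u → Star (Graph._~_ G) u (src e) → X (cls d) → X (cls e)
    go eq ε x = around (Rotation.cyclic rot _ _ eq) x
    go {d} refl (_◅_ {j = v} uv p) x =
      go {d = rev d₁} refl p (flip d₁ (around (Rotation.cyclic rot d d₁ refl) x))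
      where d₁ = dart (src d) v uv

  -- An edge with the class `f` on both sides is not part of the boundary. Bridges and pendant trees
  -- of the subgraph therefore do not add to the length, which lets short boundaries be cycles.
  Bd : Fin F → Dart G → Set
  Bd f d = cls d ≡ f × cls (rev d) ≢ f

  Bd? : ∀ f d → Dec (Bd f d)
  Bd? f d = cls d Fin.≟ f ×-dec ¬? (cls (rev d) Fin.≟ f)

  len : Fin F → ℕ
  len f = ∑ darts (λ d → ⟦ Bd? f d ⟧)

  module _ (f : Fin F) where

    -- Rotating about a vertex inside the class f.
    data Run (d : Dart G) : Dart G → Set where
      start : Run d d
      turn  : ∀ {e} → Run d e → cls (rev e) ≡ f → Run d (π e)

    run-cls : ∀ {d e} → cls d ≡ f → Run d e → cls e ≡ f
    run-cls c start      = c
    run-cls c (turn r p) = trans (cls-rot _) p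

    run-src : ∀ {d e} → Run d e → src e ≡ src d
    run-src start      = refl
    run-src (turn r p) = trans (Rotation.fix rot _) (run-src r)

    enter-cls : ∀ {d} → Bd f d → cls (π (rev d)) ≡ f
    enter-cls {d} (c , _) = trans (cls-rot (rev d)) (trans (cong cls (rev-rev d)) c)

    -- Read backwards, a run is determined by its last dart, as `π` is injective. Where it began can
    -- be recognised: the dart before its start is `rev d`, outside `f`, while all darts of the run
    -- lie in `f`.
    run-injective : ∀ {d d′ e e′} → Bd f d → Bd f d′ →
                    Run (π (rev d)) e → Run (π (rev d′)) e′ → e ≡ e′ → rev d ≡ rev d′
    run-injective b b′ start      start       eq = π-injective eq
    run-injective b b′ start      (turn r p)  eq =
      contradiction (subst (λ x → cls x ≡ f) (sym (π-injective eq)) (run-cls (enter-cls b′) r)) (proj₂ b)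
    run-injective b b′ (turn r p) start       eq =
      contradiction (subst (λ x → cls x ≡ f) (π-injective eq) (run-cls (enter-cls b) r)) (proj₂ b′)
    run-injective b b′ (turn r p) (turn r′ q) eq = run-injective b b′ r r′ (π-injective eq)

    BDart : Set
    BDart = Σ (Dart G) (Bd f)

    -- The rotation at the head of `d` eventually returns to `rev d`, which lies outside `f`; so
    -- turning inside `f` must stop before that, at a dart whose other side is not `f`.
    follow : (b : BDart) → Σ BDart λ c → Run (π (rev (proj₁ b))) (proj₁ c)
    follow (d , c , c′) = walk start (enter-cls (c , c′)) (Rotation.cyclic rot _ _ (Rotation.fix rot _))
      where
      walk : ∀ {e} → Run (π (rev d)) e → cls e ≡ f → Orbit π e (rev d) → Σ BDart λ c → Run (π (rev d)) (proj₁ c)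
      walk r p ε = contradiction p c′
      walk {e} r p (refl ◅ o) with cls (rev e) Fin.≟ f
      ... | yes q = walk (turn r q) (trans (cls-rot e) q) o
      ... | no ¬q = (e , p , ¬q) , r

    abstract
      succ′ : (d : Dart G) → Dec (Bd f d) → Dart G
      succ′ d (yes b) = proj₁ (proj₁ (follow (d , b)))
      succ′ d (no _)  = d

      succ : Dart G → Dart G
      succ d = succ′ d (Bd? f d)

      succ-run : ∀ {d} → Bd f d → Bd f (succ d) × Run (π (rev d)) (succ d)
      succ-run {d} b with Bd? f d
      ... | yes b′ = proj₂ (proj₁ (follow (d , b′))) , proj₂ (follow (d , b′))
      ... | no ¬b  = contradiction b ¬b

      succ-Bd : ∀ {d} → Bd f d → Bd f (succ d)
      succ-Bd = proj₁ ∘ succ-run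

      succ-injective : ∀ {d e} → Bd f d → Bd f e → succ d ≡ succ e → d ≡ e
      succ-injective b c eq = trans (sym (rev-rev _)) (trans (cong rev
        (run-injective b c (proj₂ (succ-run b)) (proj₂ (succ-run c)) eq)) (rev-rev _))

      succ-src : ∀ {d} → Bd f d → src (succ d) ≡ tgt d
      succ-src b = trans (run-src (proj₂ (succ-run b))) (Rotation.fix rot _)

      -- The graph is simple, so a successor ending at the source of `d` would be `rev d`, which is
      -- not in `f`. Boundary walks never turn back.
      succ-tgt : ∀ {d} → Bd f d → tgt (succ d) ≢ src d
      succ-tgt b eq = proj₂ b
        (trans (cong cls (sym (dart-≡ (succ-src b) eq))) (proj₁ (succ-Bd b)))

  -- Boundary circuits and short boundaries

  record BoundaryCycle (f : Fin F) (m : ℕ) : Set where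
    field
      cycle    : Cycle G m
      side     : Fin m → Dart G
      side-Bd  : ∀ i → Bd f (side i)
      side-src : ∀ i → src (side i) ≡ Cycle.vertex cycle i
      side-tgt : ∀ i → tgt (side i) ≡ Cycle.vertex cycle (next i)
      onto     : ∀ {e} → Bd f e → ∃ λ i → e ≡ side i

    edge⁺ : ∀ {e} → Bd f e → Cycle.HasEdge cycle (src e) (tgt e)
    edge⁺ be with i , refl ← onto be = i , inj₁ (sym (side-src i) , sym (side-tgt i))

    edge⁻ : ∀ {e} → Cycle.HasEdge cycle (src e) (tgt e) → Bd f e ⊎ Bd f (rev e)
    edge⁻ {e} (i , inj₁ (p , q)) = inj₁ (subst (Bd f) (dart-≡ (trans (side-src i) p) (trans (side-tgt i) q)) (side-Bd i))
    edge⁻ {e} (i , inj₂ (p , q)) = inj₂ (subst (Bd f) (dart-≡ (trans (side-src i) p) (trans (side-tgt i) q)) (side-Bd i))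

  module Circuit (f : Fin F) (d₀ : Dart G) (d₀-Bd : Bd f d₀) where

    dd : ℕ → Dart G
    dd zero    = d₀
    dd (suc i) = succ f (dd i)

    dd-Bd : ∀ i → Bd f (dd i)
    dd-Bd zero    = d₀-Bd
    dd-Bd (suc i) = succ-Bd f (dd-Bd i)

    pt : ℕ → Fin n
    pt i = src (dd i)

    pt-suc : ∀ i → pt (suc i) ≡ tgt (dd i)
    pt-suc i = succ-src f (dd-Bd i)

    pt≢₁ : ∀ i → pt i ≢ pt (1 + i)
    pt≢₁ i eq = src≢tgt (dd i) (trans eq (pt-suc i))

    pt≢₂ : ∀ i → pt i ≢ pt (2 + i)
    pt≢₂ i eq = succ-tgt f (dd-Bd i) (sym (trans eq (pt-suc (suc i))))

    dd-cancel : ∀ i {j k} → dd (i + j) ≡ dd (i + k) → dd j ≡ dd k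
    dd-cancel zero    eq = eq
    dd-cancel (suc i) {j} {k} eq = dd-cancel i (succ-injective f (dd-Bd (i + j)) (dd-Bd (i + k)) eq)

    dd-shift : ∀ i {j k} → dd j ≡ dd k → dd (i + j) ≡ dd (i + k)
    dd-shift zero    eq = eq
    dd-shift (suc i) eq = cong (succ f) (dd-shift i eq)

    Fresh : ℕ → Set
    Fresh m = ∀ {i} → 0 ℕ.< i → i ℕ.< m → dd i ≢ d₀

    -- As `succ` is injective on the boundary, the common initial part of a repetition can be
    -- cancelled, and any repetition becomes a return to `d₀`.
    fresh-distinct : ∀ {m} → Fresh m → ∀ {i j} → i ℕ.< j → j ℕ.< m → dd i ≢ dd j
    fresh-distinct {m} fr {i} {j} i<j j<m eq
      with o , refl ← m≤n⇒∃[o]m+o≡n i<j =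
      fr {suc o} (s≤s z≤n) (≤-trans (s≤s (m≤n+m (suc o) i)) (subst (ℕ._< m) (sym (+-suc i o)) j<m))
        (sym (dd-cancel i (trans (cong dd (+-identityʳ i)) (trans eq (cong dd (sym (+-suc i o)))))))

    fresh₃ : Fresh 3
    fresh₃ {1} _ _ eq = pt≢₁ 0 (cong src (sym eq))
    fresh₃ {2} _ _ eq = pt≢₂ 0 (cong src (sym eq))
    fresh₃ {suc (suc (suc _))} _ (s≤s (s≤s (s≤s ())))

    fresh-suc : ∀ {m} → Fresh m → dd m ≢ d₀ → Fresh (suc m)
    fresh-suc fr ne 0<i i<1+m with m≤n⇒m<n∨m≡n (s≤s⁻¹ i<1+m)
    ... | inj₁ i<m  = fr 0<i i<m
    ... | inj₂ refl = ne

    fresh-unique : ∀ {m} → Fresh m → Unique (applyUpTo dd m)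
    fresh-unique {m} fr = applyUpTo⁺₁ dd m (fresh-distinct fr)

    fresh-len : ∀ {m} → Fresh m → m ≤ len f
    fresh-len {m} fr = subst (_≤ len f) (List.length-applyUpTo dd m)
      (length≤∑ _ (fresh-unique fr) (λ _ → ∈-darts _) pos)
      where
      pos : ∀ {e} → e ∈ applyUpTo dd m → 1 ≤ ⟦ Bd? f e ⟧
      pos e∈ with i , _ , refl ← ∈-applyUpTo⁻ dd e∈ = ≤-reflexive (sym (⟦⟧-yes (Bd? f (dd i)) (dd-Bd i)))

  module _ (f : Fin F) (d₀ : Dart G) (d₀-Bd : Bd f d₀) {m : ℕ}
           (fresh : Circuit.Fresh f d₀ d₀-Bd (suc m)) (return : Circuit.dd f d₀ d₀-Bd (suc m) ≡ d₀) where

    open Circuit f d₀ d₀-Bd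

    OnCircuit : Dart G → Set
    OnCircuit e = ∃ λ i → i ℕ.< suc m × e ≡ dd i

    onCircuit-back : ∀ {e} → Bd f e → OnCircuit (succ f e) → OnCircuit e
    onCircuit-back be (zero  , _  , eq) = m , ≤-refl , succ-injective f be (dd-Bd m) (trans eq (sym return))
    onCircuit-back be (suc i , lt , eq) = i , <-trans (n<1+n i) lt , succ-injective f be (dd-Bd i) eq

    -- A second circuit would contribute three more boundary darts.
    circuit-onto : 3 ≤ suc m → len f ℕ.< 6 → ∀ {e} → Bd f e → OnCircuit e
    circuit-onto 3≤m len<6 {e} be with DecMembership._∈?_ _≟ᵈ_ e (applyUpTo dd (suc m))
    ... | yes e∈ = ∈-applyUpTo⁻ dd e∈
    ... | no e∉  = contradiction (≤-trans (+-monoˡ-≤ 3 3≤m) enough) (<⇒≱ len<6)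
      where
      module E = Circuit f e be

      off : ∀ j → ¬ OnCircuit (E.dd j)
      off zero    (i , lt , refl) = e∉ (∈-applyUpTo⁺ dd lt)
      off (suc j) on              = off j (onCircuit-back (E.dd-Bd j) on)

      both : List (Dart G)
      both = applyUpTo dd (suc m) ++ applyUpTo E.dd 3

      both-unique : Unique both
      both-unique = ++⁺ (fresh-unique fresh) (E.fresh-unique E.fresh₃) λ (x∈ , y∈) →
        let i , i<m , eq = ∈-applyUpTo⁻ dd x∈ ; j , _ , eq′ = ∈-applyUpTo⁻ E.dd {n = 3} y∈ in
        off j (i , i<m , trans (sym eq′) eq)

      pos : ∀ {x} → x ∈ both → 1 ≤ ⟦ Bd? f x ⟧
      pos {x} x∈ with ∈-++⁻ (applyUpTo dd (suc m)) x∈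
      ... | inj₁ x∈₁ with i , _ , refl ← ∈-applyUpTo⁻ dd x∈₁ = ≤-reflexive (sym (⟦⟧-yes (Bd? f x) (dd-Bd i)))
      ... | inj₂ x∈₂ with j , _ , refl ← ∈-applyUpTo⁻ E.dd {n = 3} x∈₂ = ≤-reflexive (sym (⟦⟧-yes (Bd? f x) (E.dd-Bd j)))

      enough : suc m + 3 ≤ len f
      enough = subst (_≤ len f)
        (trans (List.length-++ (applyUpTo dd (suc m))) (cong (_+ 3) (List.length-applyUpTo dd (suc m))))
        (length≤∑ _ both-unique (λ _ → ∈-darts _) pos)

    circuit-len : 3 ≤ suc m → len f ℕ.< 6 → len f ≡ suc m
    circuit-len 3≤m len<6 = ≤-antisym
      (begin
        len f
          ≤⟨ ∑-cover _ darts-unique (λ {e} _ h → inList (⟦⟧≢0⇒ (Bd? f e) h)) ⟩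
        ∑ (applyUpTo dd (suc m)) (λ d → ⟦ Bd? f d ⟧)
          ≤⟨ ∑-mono (applyUpTo dd (suc m)) (λ d → ⟦⟧≤1 (Bd? f d)) ⟩
        ∑ (applyUpTo dd (suc m)) (λ _ → 1)
          ≡⟨ trans (∑-const (applyUpTo dd (suc m)) 1) (*-identityʳ _) ⟩
        length (applyUpTo dd (suc m))
          ≡⟨ List.length-applyUpTo dd (suc m) ⟩
        suc m ∎)
      (fresh-len fresh)
      where
      open ≤-Reasoning
      inList : ∀ {e} → Bd f e → e ∈ applyUpTo dd (suc m)
      inList be with i , lt , refl ← circuit-onto 3≤m len<6 be = ∈-applyUpTo⁺ dd lt

    pt-period : ∀ i → pt (i + suc m) ≡ pt i
    pt-period i = cong src (trans (dd-shift i return) (cong dd (+-identityʳ i)))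

    pt-next : (i : Fin (suc m)) → pt (toℕ (next i)) ≡ tgt (dd (toℕ i))
    pt-next i with toℕ-next i
    ... | inj₁ eq         = trans (cong pt eq) (pt-suc (toℕ i))
    ... | inj₂ (eq , eq₀) = begin
      pt (toℕ (next i))   ≡⟨ cong pt eq₀ ⟩
      pt 0                ≡⟨ cong src return ⟨
      pt (suc m)          ≡⟨ cong pt eq ⟨
      pt (suc (toℕ i))    ≡⟨ pt-suc (toℕ i) ⟩
      tgt (dd (toℕ i))    ∎
      where open ≡-Reasoning

    -- On a closed walk of length at most 5 any two positions are at cyclic
    -- distance at most 2.
    pt-distinct : suc m ≤ 5 → ∀ {i j} → i ℕ.< j → j ℕ.< suc m → pt i ≢ pt j
    pt-distinct m≤5 {i} i<j j<m eq with m≤n⇒∃[o]m+o≡n i<j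
    ... | 0 , refl = pt≢₁ i (trans eq (cong (pt ∘ suc) (+-identityʳ i)))
    ... | 1 , refl = pt≢₂ i (trans eq (cong (pt ∘ suc) (+-comm i 1)))
    ... | suc (suc δ) , refl with m≤n⇒∃[o]m+o≡n j<m
    ... | ρ , eqₘ = close (i + ρ) small (trans (cong pt wrap) (trans (pt-period i) eq))
      where
      open +-*-Solver
      j : ℕ
      j = suc i + suc (suc δ)
      -- Here `j` is at least three steps after `i`. Going on from `j` past the end of the circuit,
      -- position `i` recurs after `suc (i + ρ)` steps, which is at most 2 because the length is at
      -- most 5.
      wrap : suc (i + ρ) + j ≡ i + suc m
      wrap = trans (solve 3 (λ i δ ρ → con 1 :+ (i :+ ρ) :+ (con 1 :+ i :+ (con 2 :+ δ))
                                    := i :+ (con 2 :+ i :+ (con 2 :+ δ) :+ ρ)) refl i δ ρ)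
                   (cong (i +_) eqₘ)
      small : i + ρ ≤ 1
      small = +-cancelˡ-≤ 4 _ _ (≤-trans
        (≤-trans (+-monoʳ-≤ 4 (m≤n+m (i + ρ) δ))
                 (≤-reflexive (trans (solve 3 (λ i δ ρ → con 4 :+ (δ :+ (i :+ ρ))
                   := con 2 :+ i :+ (con 2 :+ δ) :+ ρ) refl i δ ρ) eqₘ)))
        m≤5)
      close : ∀ x → x ≤ 1 → pt (suc x + j) ≢ pt j
      close 0 _ eq = pt≢₁ j (sym eq)
      close 1 _ eq = pt≢₂ j (sym eq)
      close (suc (suc _)) (s≤s ())

    boundaryCycle : 3 ≤ suc m → suc m ≤ 5 → len f ℕ.< 6 → BoundaryCycle f (suc m)
    boundaryCycle 3≤m m≤5 len<6 = record
      { cycle = record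
          { vertex    = pt ∘ toℕ
          ; injective = inj
          ; closed    = λ i → subst (Graph._~_ G (pt (toℕ i))) (sym (pt-next i)) (edge (dd (toℕ i)))
          }
      ; side     = dd ∘ toℕ
      ; side-Bd  = dd-Bd ∘ toℕ
      ; side-src = λ i → refl
      ; side-tgt = λ i → sym (pt-next i)
      ; onto     = λ be → let i , lt , eq = circuit-onto 3≤m len<6 be in
                          fromℕ< lt , trans eq (cong dd (sym (Fin.toℕ-fromℕ< lt)))
      }
      where
      inj : ∀ {i j : Fin (suc m)} → pt (toℕ i) ≡ pt (toℕ j) → i ≡ j
      inj {i} {j} eq with <-cmp (toℕ i) (toℕ j)
      ... | tri< lt _ _   = contradiction eq (pt-distinct m≤5 lt (Fin.toℕ<n j))
      ... | tri≈ _ i≡j _  = Fin.toℕ-injective i≡j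
      ... | tri> _ _ lt   = contradiction (sym eq) (pt-distinct m≤5 lt (Fin.toℕ<n i))

  data Shape (f : Fin F) : Set where
    empty : (∀ d → ¬ Bd f d) → Shape f
    cyclic : ∀ {m} → 3 ≤ m → m ≤ 5 → len f ≡ m → BoundaryCycle f m → Shape f
    long  : 6 ≤ len f → Shape f

  -- A circuit cannot close in fewer than three steps. If it does not close after 3, 4 or 5 steps
  -- either, its first six darts are distinct, too many for a boundary shorter than 6.
  shape : ∀ f → Shape f
  shape f with All.all? (λ d → ¬? (Bd? f d)) darts
  ... | yes none = empty (λ d → All.lookup none (∈-darts d))
  ... | no some with d₀ , _ , ¬¬b ← find (All.¬All⇒Any¬ (λ d → ¬? (Bd? f d)) darts some)
                | 6 ≤? len f
  ... | yes 6≤ = long 6≤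
  ... | no 6≰ = go
    where
    b : Bd f d₀
    b = decidable-stable (Bd? f d₀) ¬¬b
    open Circuit f d₀ b
    len<6 : len f ℕ.< 6
    len<6 = ≰⇒> 6≰
    close : ∀ m → Fresh (suc m) → dd (suc m) ≡ d₀ → 3 ≤ suc m → suc m ≤ 5 → Shape f
    close m fr ret 3≤m m≤5 = cyclic 3≤m m≤5 (circuit-len f d₀ b fr ret 3≤m len<6)
                                    (boundaryCycle f d₀ b fr ret 3≤m m≤5 len<6)
    go : Shape f
    go with dd 3 ≟ᵈ d₀
    ... | yes r₃ = close 2 fresh₃ r₃ (from-yes (3 ≤? 3)) (from-yes (3 ≤? 5))
    ... | no n₃ with dd 4 ≟ᵈ d₀
    ... | yes r₄ = close 3 (fresh-suc fresh₃ n₃) r₄ (from-yes (3 ≤? 4)) (from-yes (4 ≤? 5))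
    ... | no n₄ with dd 5 ≟ᵈ d₀
    ... | yes r₅ = close 4 (fresh-suc (fresh-suc fresh₃ n₃) n₄) r₅ (from-yes (3 ≤? 5)) (from-yes (5 ≤? 5))
    ... | no n₅ = contradiction (fresh-len (fresh-suc (fresh-suc (fresh-suc fresh₃ n₃) n₄) n₅)) (<⇒≱ len<6)

-- Discharging

module _ {G : Graph n} where

  open Graph G using (_~_)
  open Cycle

  hasEdge-sym : (C : Cycle G k) {u v : Fin n} → HasEdge C u v → HasEdge C v u
  hasEdge-sym C (i , inj₁ p) = i , inj₂ p
  hasEdge-sym C (i , inj₂ p) = i , inj₁ p

  hasEdge⇒~ : (C : Cycle G k) {u v : Fin n} → HasEdge C u v → u ~ v
  hasEdge⇒~ C (i , inj₁ (refl , refl)) = closed C i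
  hasEdge⇒~ C (i , inj₂ (refl , refl)) = Graph.sym G (closed C i)

  _On_ : Fin n → Cycle G k → Set
  u On C = ∃ λ i → vertex C i ≡ u

  hasEdge⇒on : (C : Cycle G k) {u v : Fin n} → HasEdge C u v → u On C × v On C
  hasEdge⇒on C (i , inj₁ (p , q)) = (i , p) , (next i , q)
  hasEdge⇒on C (i , inj₂ (p , q)) = (next i , q) , (i , p)

  triangle-edge : (T : Triangle G) {u v : Fin n} → u On T → v On T → u ≢ v → HasEdge T u v
  triangle-edge T (i , refl) (j , refl) u≢v with consecutive i j
    where
    consecutive : (i j : Fin 3) → i ≡ j ⊎ next i ≡ j ⊎ next j ≡ i
    consecutive = toWitness {a? = Fin.all? λ i → Fin.all? λ j → i Fin.≟ j ⊎-dec (next i Fin.≟ j ⊎-dec next j Fin.≟ i)} _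
  ... | inj₁ refl        = contradiction refl u≢v
  ... | inj₂ (inj₁ refl) = i , inj₁ (refl , refl)
  ... | inj₂ (inj₂ refl) = j , inj₂ (refl , refl)

  triangle-≤3 : (T : Triangle G) {us : List (Fin n)} → Unique us → All (_On T) us → length us ≤ 3
  triangle-≤3 T {us} uniq on = ≤-trans (unique-length {xs = map (vertex T) (allFin 3)} uniq inside) ≤-refl
    where
    inside : ∀ {u} → u ∈ us → u ∈ map (vertex T) (allFin 3)
    inside u∈ with i , refl ← All.lookup on u∈ = ∈-map⁺ (vertex T) (∈-allFin i)

  quadrilateral : {a b c d : Fin n} → a ≢ c → b ≢ d → a ~ b → b ~ c → c ~ d → d ~ a → Cycle G 4
  quadrilateral {a} {b} {c} {d} a≢c b≢d ab bc cd da = record { vertex = V ; injective = inj _ _ ; closed = cl }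
    where
    V : Fin 4 → Fin n
    V zero                   = a
    V (suc zero)             = b
    V (suc (suc zero))       = c
    V (suc (suc (suc zero))) = d
    ne : ∀ {u v} → u ~ v → u ≢ v
    ne e refl = Graph.irrefl G e
    cl : ∀ i → V i ~ V (next i)
    cl zero                   = ab
    cl (suc zero)             = bc
    cl (suc (suc zero))       = cd
    cl (suc (suc (suc zero))) = da
    inj : ∀ i j → V i ≡ V j → i ≡ j
    inj zero                   zero                   _  = refl
    inj zero                   (suc zero)             eq = contradiction eq (ne ab)
    inj zero                   (suc (suc zero))       eq = contradiction eq a≢c
    inj zero                   (suc (suc (suc zero))) eq = contradiction (sym eq) (ne da)
    inj (suc zero)             zero                   eq = contradiction (sym eq) (ne ab)
    inj (suc zero)             (suc zero)             _  = refl
    inj (suc zero)             (suc (suc zero))       eq = contradiction eq (ne bc)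
    inj (suc zero)             (suc (suc (suc zero))) eq = contradiction eq b≢d
    inj (suc (suc zero))       zero                   eq = contradiction (sym eq) a≢c
    inj (suc (suc zero))       (suc zero)             eq = contradiction (sym eq) (ne bc)
    inj (suc (suc zero))       (suc (suc zero))       _  = refl
    inj (suc (suc zero))       (suc (suc (suc zero))) eq = contradiction eq (ne cd)
    inj (suc (suc (suc zero))) zero                   eq = contradiction eq (ne da)
    inj (suc (suc (suc zero))) (suc zero)             eq = contradiction (sym eq) b≢d
    inj (suc (suc (suc zero))) (suc (suc zero))       eq = contradiction (sym eq) (ne cd)
    inj (suc (suc (suc zero))) (suc (suc (suc zero))) _  = refl

  -- Triangles along a 5-cycle

  module _ (noT4 : NoTriangleAdjacentTo4Cycle G) (C : Cycle G 5) (T : Triangle G) where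

    private
      V : Fin 5 → Fin n
      V = vertex C

      Side : Fin 5 → Set
      Side i = HasEdge T (V i) (V (next i))

      distinct : (i : Fin 5) → i ≢ next i × i ≢ next (next i) × i ≢ next (next (next i))
               × next (next (next (next (next i)))) ≡ i
      distinct = toWitness {a? = Fin.all? λ i → ¬? (i Fin.≟ next i) ×-dec ¬? (i Fin.≟ next (next i))
        ×-dec ¬? (i Fin.≟ next (next (next i))) ×-dec next (next (next (next (next i)))) Fin.≟ i} _

      V≢₁ : ∀ i → V i ≢ V (next i)
      V≢₁ i eq = proj₁ (distinct i) (injective C eq)

      V≢₂ : ∀ i → V i ≢ V (next (next i))
      V≢₂ i eq = proj₁ (proj₂ (distinct i)) (injective C eq)

      V≢₃ : ∀ i → V i ≢ V (next (next (next i)))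
      V≢₃ i eq = proj₁ (proj₂ (proj₂ (distinct i))) (injective C eq)

    -- The third edge of the triangle cuts off a 4-cycle.
    no-consecutive-sides : ∀ i → Side i → ¬ Side (next i)
    no-consecutive-sides i h h′ = noT4 T □ (V i , V (next (next i)) , chord , zero , inj₁ (refl , refl))
      where
      chord : HasEdge T (V i) (V (next (next i)))
      chord = triangle-edge T (proj₁ (hasEdge⇒on T h)) (proj₂ (hasEdge⇒on T h′)) (V≢₂ i)
      □ : Cycle G 4
      □ = quadrilateral {d = V (next (next (next (next i))))}
            (V≢₃ i) (V≢₂ (next (next i))) (hasEdge⇒~ T chord) (closed C _) (closed C _)
            (subst (λ x → V (next (next (next (next i)))) ~ V x) (proj₂ (proj₂ (proj₂ (distinct i)))) (closed C _))

    no-opposite-sides : ∀ i → Side i → ¬ Side (next (next i))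
    no-opposite-sides i h h′ with a , b ← hasEdge⇒on T h | c , d ← hasEdge⇒on T h′ =
      contradiction (triangle-≤3 T
        ((V≢₁ i ∷ V≢₂ i ∷ V≢₃ i ∷ []) ∷ (V≢₁ _ ∷ V≢₂ _ ∷ []) ∷ (V≢₁ _ ∷ []) ∷ [] ∷ [])
        (a ∷ b ∷ c ∷ d ∷ [])) λ { (s≤s (s≤s (s≤s ()))) }

    -- Two sides of a 5-cycle are consecutive or separated by one side; in the latter case they
    -- would put four vertices on the triangle. Consequently the triangles across different sides
    -- are different, and a bound on adjacent triangles becomes a bound on the sides through which a
    -- 5-cycle pays.
    one-side : ∀ {i j} → Side i → Side j → i ≡ j
    one-side {i} {j} hi hj with position i j
      where
      position : (i j : Fin 5) → i ≡ j ⊎ next i ≡ j ⊎ next j ≡ i ⊎ next (next i) ≡ j ⊎ next (next j) ≡ i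
      position = toWitness {a? = Fin.all? λ i → Fin.all? λ j → i Fin.≟ j ⊎-dec (next i Fin.≟ j ⊎-dec (next j Fin.≟ i
        ⊎-dec (next (next i) Fin.≟ j ⊎-dec next (next j) Fin.≟ i)))} _
    ... | inj₁ i≡j                       = i≡j
    ... | inj₂ (inj₁ refl)               = contradiction hj (no-consecutive-sides i hi)
    ... | inj₂ (inj₂ (inj₁ refl))        = contradiction hi (no-consecutive-sides j hj)
    ... | inj₂ (inj₂ (inj₂ (inj₁ refl))) = contradiction hj (no-opposite-sides i hi)
    ... | inj₂ (inj₂ (inj₂ (inj₂ refl))) = contradiction hi (no-opposite-sides j hj)

unique-lookup : {xs : List A} → Unique xs → ∀ {i j} → lookup xs i ≡ lookup xs j → i ≡ j
unique-lookup {xs = x ∷ xs} (x∉ ∷ u) {zero}  {zero}  eq = refl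
unique-lookup {xs = x ∷ xs} (x∉ ∷ u) {zero}  {suc j} eq = contradiction eq (All.lookup x∉ (∈-lookup j))
unique-lookup {xs = x ∷ xs} (x∉ ∷ u) {suc i} {zero}  eq = contradiction (sym eq) (All.lookup x∉ (∈-lookup i))
unique-lookup {xs = x ∷ xs} (x∉ ∷ u) {suc i} {suc j} eq = cong suc (unique-lookup u eq)

-- Covers the missing charge 4 of a class with empty boundary (P) and, twice over,
-- the missing charge 1 of each of two classes with the same triangle (Q).
penalty : {P Q : Set} → Dec P → Dec Q → ℕ
penalty p q = 4 * ⟦ p ⟧ + 2 * ⟦ q ⟧

penalty≤4 : {P Q : Set} (p : Dec P) (q : Dec Q) → ¬ (P × Q) → penalty p q ≤ 4
penalty≤4 (yes x) (yes y) ¬xy = contradiction (x , y) ¬xy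
penalty≤4 (yes _) (no _)  _   = ≤-refl
penalty≤4 (no _)  q       _   = ≤-trans (*-monoʳ-≤ 2 (⟦⟧≤1 q)) (from-yes (2 ≤? 4))

4≤penalty : {P Q : Set} (p : Dec P) (q : Dec Q) → P → 4 ≤ penalty p q
4≤penalty (yes _) q _ = m≤m+n 4 (2 * ⟦ q ⟧)
4≤penalty (no ¬x) q x = contradiction x ¬x

2≤penalty : {P Q : Set} (p : Dec P) (q : Dec Q) → Q → 2 ≤ penalty p q
2≤penalty p (yes _) _ = m≤n+m 2 (4 * ⟦ p ⟧)
2≤penalty p (no ¬y) y = contradiction y ¬y

penalty-right : {P Q : Set} (p : Dec P) (q : Dec Q) → ¬ P → penalty p q ≤ 2
penalty-right (yes x) q ¬x = contradiction x ¬x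
penalty-right (no _)  q _  = *-monoʳ-≤ 2 (⟦⟧≤1 q)

penalty≢0 : {P Q : Set} (p : Dec P) (q : Dec Q) → penalty p q ≢ 0 → P ⊎ Q
penalty≢0 (yes x) _       _ = inj₁ x
penalty≢0 (no _)  (yes y) _ = inj₂ y
penalty≢0 (no _)  (no _)  h = contradiction refl h

module Discharging {n} {G : Graph n} (rot : Rotation G) {F : ℕ} (cls : Dart G → Fin F)
  (cls-rot : ∀ d → cls (Inverse.to (Rotation.perm rot) d) ≡ cls (rev d))
  (rep : ∀ f → ∃ λ d → cls d ≡ f)
  (noTT : NoTriangleAdjacentToTriangle G)
  (noT4 : NoTriangleAdjacentTo4Cycle G)
  (five : 5CyclesAdjacentToAtMost3Triangles G) where

  open Darts G
  open Boundary rot cls cls-rot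
  open BoundaryCycle

  Tri : Fin F → Set
  Tri f = len f ≡ 3

  tri? : ∀ f → Dec (Tri f)
  tri? f = len f ≟ 3

  len≡0⇒ : ∀ {f d} → len f ≡ 0 → ¬ Bd f d
  len≡0⇒ {f} {d} l≡0 b = contradiction
    (≤-trans (≤-reflexive (sym (⟦⟧-yes (Bd? f d) b))) (≤-trans (∈⇒≤∑ _ (∈-darts d)) (≤-reflexive l≡0))) λ ()

  empty⇒len≡0 : ∀ {f} → (∀ d → ¬ Bd f d) → len f ≡ 0
  empty⇒len≡0 {f} none = n≤0⇒n≡0 (∑-cover {ys = []} _ darts-unique λ {d} _ h → ⊥-elim (none d (⟦⟧≢0⇒ (Bd? f d) h)))

  triangle : ∀ {f} → Tri f → BoundaryCycle f 3
  triangle {f} t with shape f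
  ... | empty none       = contradiction (trans (sym (empty⇒len≡0 none)) t) λ ()
  ... | cyclic _ _ l≡m c = subst (BoundaryCycle f) (trans (sym l≡m) t) c
  ... | long 6≤          = contradiction (subst (6 ≤_) t 6≤) λ { (s≤s (s≤s (s≤s ()))) }

  opposite : ∀ {f d} → Bd f d → Bd (cls (rev d)) (rev d)
  opposite {f} {d} (c , c′) = refl , λ eq → c′ (trans (sym eq) (trans (cong cls (rev-rev d)) c))

  oppositeTriangle : ∀ {d} → Tri (cls (rev d)) → Triangle G
  oppositeTriangle t = cycle (triangle t)

  oppositeTriangle-edge : ∀ {f d} → Bd f d → (t : Tri (cls (rev d))) →
                          Cycle.HasEdge (oppositeTriangle {d} t) (src d) (tgt d)
  oppositeTriangle-edge b t = hasEdge-sym (cycle (triangle t)) (edge⁺ (triangle t) (opposite b))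

  -- Three times the charge that the class of d gives to the class of rev d.
  send : Dart G → ℕ
  send d = ⟦ tri? (cls (rev d)) ×-dec ¬? (tri? (cls d)) ⟧

  Twin : Fin F → Set
  Twin f = Tri f × ∃ λ d → Bd f d × Tri (cls (rev d))

  twin? : ∀ f → Dec (Twin f)
  twin? f = tri? f ×-dec map′ (λ a → let d , _ , p = find a in d , p) (λ (d , p) → lose (∈-darts d) p)
                              (any? (λ d → Bd? f d ×-dec tri? (cls (rev d))) darts)

  deficit : Fin F → ℕ
  deficit f = penalty (len f ≟ 0) (twin? f)

  around : (Dart G → ℕ) → Fin F → ℕ
  around g f = ∑ darts (λ d → ⟦ Bd? f d ⟧ * g d)

  around-cong : ∀ {g h} f → (∀ {d} → Bd f d → g d ≡ h d) → around g f ≡ around h f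
  around-cong {g} {h} f eq = ∑-cong darts λ d → step d (Bd? f d)
    where
    step : ∀ d (b? : Dec (Bd f d)) → ⟦ b? ⟧ * g d ≡ ⟦ b? ⟧ * h d
    step d (yes b) = cong (_+ 0) (eq b)
    step d (no _)  = refl

  around-1 : ∀ f → around (λ _ → 1) f ≡ len f
  around-1 f = ∑-cong darts (λ d → *-identityʳ _)

  around-0 : ∀ f → around (λ _ → 0) f ≡ 0
  around-0 f = trans (∑-cong darts (λ d → *-zeroʳ ⟦ Bd? f d ⟧)) (trans (∑-const darts 0) (*-zeroʳ (length darts)))

  around-mono : ∀ {g h} f → (∀ d → g d ≤ h d) → around g f ≤ around h f
  around-mono f le = ∑-mono darts (λ d → *-monoʳ-≤ ⟦ Bd? f d ⟧ (le d))

  send-pentagon : ∀ f → BoundaryCycle f 5 → around send f ≤ 3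
  send-pentagon f c = begin
    around send f
      ≤⟨ ∑-cover {ys = map (side c) (allFin 5)} _ darts-unique (λ {d} _ h → onSide (⟦⟧*≢0⇒ (Bd? f d) h)) ⟩
    ∑ (map (side c) (allFin 5)) (λ d → ⟦ Bd? f d ⟧ * send d)
      ≡⟨ ∑-map (side c) (allFin 5) (λ d → ⟦ Bd? f d ⟧ * send d) ⟩
    ∑ (allFin 5) (λ i → ⟦ Bd? f (side c i) ⟧ * send (side c i))
      ≤⟨ ∑-mono (allFin 5) (λ i → ≤-trans (⟦⟧*≤ (Bd? f (side c i)) (send (side c i)))
           (⟦⟧-mono (tri? (cls (rev (side c i))) ×-dec ¬? (tri? (cls (side c i)))) (P? i) proj₁)) ⟩
    ∑ (allFin 5) (λ i → ⟦ P? i ⟧)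
      ≡⟨ length-filter≡∑ P? (allFin 5) ⟨
    length is
      ≤⟨ five (cycle c) (length is) Ts different touching ⟩
    3 ∎
    where
    open ≤-Reasoning
    P? : Decidable (λ i → Tri (cls (rev (side c i))))
    P? i = tri? (cls (rev (side c i)))

    onSide : ∀ {d} → Bd f d → d ∈ map (side c) (allFin 5)
    onSide b with i , refl ← onto c b = ∈-map⁺ (side c) (∈-allFin i)

    is : List (Fin 5)
    is = filter P? (allFin 5)

    is-tri : ∀ a → Tri (cls (rev (side c (lookup is a))))
    is-tri a = proj₂ (∈-filter⁻ P? {xs = allFin 5} (∈-lookup {xs = is} a))

    Ts : Fin (length is) → Triangle G
    Ts a = oppositeTriangle {side c (lookup is a)} (is-tri a)

    Ts-edge : ∀ a → Cycle.HasEdge (Ts a) (Cycle.vertex (cycle c) (lookup is a)) (Cycle.vertex (cycle c) (next (lookup is a)))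
    Ts-edge a = subst₂ (Cycle.HasEdge (Ts a)) (side-src c (lookup is a)) (side-tgt c (lookup is a))
      (oppositeTriangle-edge (side-Bd c (lookup is a)) (is-tri a))

    different : ∀ a b → a ≢ b → ¬ SameCycle (Ts a) (Ts b)
    different a b a≢b same = a≢b (unique-lookup (filter⁺ P? (allFin⁺ 5))
      (one-side noT4 (cycle c) (Ts b) (Equivalence.to (same _ _) (Ts-edge a)) (Ts-edge b)))

    touching : ∀ a → Adjacent (cycle c) (Ts a)
    touching a = _ , _ , (lookup is a , inj₁ (refl , refl)) , Ts-edge a

  send-none : ∀ f → (∀ {d} → Bd f d → send d ≡ 0) → around send f ≡ 0
  send-none f h = trans (around-cong f h) (around-0 f)

  quadrilateral-send : ∀ {f} → BoundaryCycle f 4 → ∀ {d} → Bd f d → send d ≡ 0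
  quadrilateral-send c {d} b = ⟦⟧-no (tri? (cls (rev d)) ×-dec ¬? (tri? (cls d))) λ (t , _) →
    noT4 (oppositeTriangle {d} t) (cycle c) (src d , tgt d , oppositeTriangle-edge b t , edge⁺ c b)

  triangle-send : ∀ {f} → Tri f → ∀ {d} → Bd f d → send d ≡ 0
  triangle-send t {d} (refl , _) = ⟦⟧-no (tri? (cls (rev d)) ×-dec ¬? (tri? (cls d))) λ (_ , ¬t) → ¬t t

  triangle-receive : ∀ {f} → Tri f → ¬ Twin f → ∀ {d} → Bd f d → send (rev d) ≡ 1
  triangle-receive {f} t ¬tw {d} b@(c , _) =
    ⟦⟧-yes (tri? (cls (rev (rev d))) ×-dec ¬? (tri? (cls (rev d))))
      (subst Tri (sym (trans (cong cls (rev-rev d)) c)) t , λ t′ → ¬tw (t , d , b , t′))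

  -- The final charge of `f`, with its deficit made up, is nonnegative; everything is multiplied by
  -- 3 and subtractions are moved across. Tight cases are a triangle paid from three sides (12 = 9 +
  -- 3), a 4-cycle, a 5-cycle with three payments (12 + 3 = 15) and length 6 with six payments (12 +
  -- 6 = 18).
  charge : ∀ f → 12 + around send f ≤ 3 * len f + around (send ∘ rev) f + 3 * deficit f
  charge f with shape f
  ... | empty none = begin
    12 + around send f         ≡⟨ cong (12 +_) (send-none f (λ b → ⊥-elim (none _ b))) ⟩
    3 * 4                      ≤⟨ *-monoʳ-≤ 3 (4≤penalty (len f ≟ 0) (twin? f) (empty⇒len≡0 none)) ⟩
    3 * deficit f              ≤⟨ m≤n+m (3 * deficit f) (3 * len f + around (send ∘ rev) f) ⟩
    3 * len f + around (send ∘ rev) f + 3 * deficit f ∎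
    where open ≤-Reasoning
  ... | long 6≤ = begin
    12 + around send f         ≤⟨ +-monoʳ-≤ 12 (around-mono f (λ d → ⟦⟧≤1 (tri? (cls (rev d)) ×-dec ¬? (tri? (cls d))))) ⟩
    12 + around (λ _ → 1) f    ≡⟨ cong (12 +_) (around-1 f) ⟩
    2 * 6 + len f              ≤⟨ +-monoˡ-≤ (len f) (*-monoʳ-≤ 2 6≤) ⟩
    2 * len f + len f          ≡⟨ +-comm (2 * len f) (len f) ⟩
    3 * len f                  ≤⟨ ≤-trans (m≤m+n (3 * len f) (around (send ∘ rev) f)) (m≤m+n _ (3 * deficit f)) ⟩
    3 * len f + around (send ∘ rev) f + 3 * deficit f ∎
    where open ≤-Reasoning
  ... | cyclic {0} () _ _ _
  ... | cyclic {1} (s≤s ()) _ _ _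
  ... | cyclic {2} (s≤s (s≤s ())) _ _ _
  ... | cyclic {3} _ _ t _ = begin
    12 + around send f         ≡⟨ cong (12 +_) (send-none f (triangle-send t)) ⟩
    9 + 3                      ≤⟨ +-monoʳ-≤ 9 (compensated (twin? f)) ⟩
    3 * 3 + (around (send ∘ rev) f + 3 * deficit f)     ≡⟨ cong (λ l → 3 * l + (around (send ∘ rev) f + 3 * deficit f)) t ⟨
    3 * len f + (around (send ∘ rev) f + 3 * deficit f) ≡⟨ +-assoc (3 * len f) _ _ ⟨
    3 * len f + around (send ∘ rev) f + 3 * deficit f ∎
    where
    open ≤-Reasoning
    compensated : Dec (Twin f) → 3 ≤ around (send ∘ rev) f + 3 * deficit f
    compensated (yes tw) = ≤-trans (≤-trans (from-yes (3 ≤? 6)) (*-monoʳ-≤ 3 (2≤penalty (len f ≟ 0) (twin? f) tw)))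
                                   (m≤n+m (3 * deficit f) (around (send ∘ rev) f))
    compensated (no ¬tw) = ≤-trans
      (≤-reflexive (sym (trans (around-cong f (triangle-receive t ¬tw)) (trans (around-1 f) t))))
      (m≤m+n (around (send ∘ rev) f) (3 * deficit f))
  ... | cyclic {4} _ _ l≡4 c = begin
    12 + around send f         ≡⟨ cong (12 +_) (send-none f (quadrilateral-send c)) ⟩
    3 * 4                      ≡⟨ cong (3 *_) l≡4 ⟨
    3 * len f                  ≤⟨ ≤-trans (m≤m+n (3 * len f) (around (send ∘ rev) f)) (m≤m+n _ (3 * deficit f)) ⟩
    3 * len f + around (send ∘ rev) f + 3 * deficit f ∎
    where open ≤-Reasoning
  ... | cyclic {5} _ _ l≡5 c = begin
    12 + around send f         ≤⟨ +-monoʳ-≤ 12 (send-pentagon f c) ⟩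
    3 * 5                      ≡⟨ cong (3 *_) l≡5 ⟨
    3 * len f                  ≤⟨ ≤-trans (m≤m+n (3 * len f) (around (send ∘ rev) f)) (m≤m+n _ (3 * deficit f)) ⟩
    3 * len f + around (send ∘ rev) f + 3 * deficit f ∎
    where open ≤-Reasoning
  ... | cyclic {suc (suc (suc (suc (suc (suc _)))))} _ (s≤s (s≤s (s≤s (s≤s (s≤s ()))))) _ _

  crossing : Dart G → ℕ
  crossing d = ⟦ ¬? (cls d Fin.≟ cls (rev d)) ⟧

  crossing-rev : ∀ d → crossing (rev d) ≡ crossing d
  crossing-rev d = ⟦⟧-cong (¬? (cls (rev d) Fin.≟ cls (rev (rev d)))) (¬? (cls d Fin.≟ cls (rev d)))
    (λ ne eq → ne (trans (sym eq) (cong cls (sym (rev-rev d)))))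
    (λ ne eq → ne (trans (cong cls (sym (rev-rev d))) (sym eq)))

  -- A dart can be on the boundary of its own class only, and is so exactly when it separates two
  -- classes.
  ∑-around : ∀ g → ∑ (allFin F) (around g) ≡ ∑ darts (λ d → crossing d * g d)
  ∑-around g = sym (trans (∑-fibres cls darts _)
    (∑-cong (allFin F) (λ f → ∑-cong darts (λ d → trans (sym (*-assoc ⟦ cls d Fin.≟ f ⟧ (crossing d) (g d)))
      (cong (_* g d) (trans (sym (⟦⟧-× (cls d Fin.≟ f) (¬? (cls d Fin.≟ cls (rev d)))))
        (⟦⟧-cong (cls d Fin.≟ f ×-dec ¬? (cls d Fin.≟ cls (rev d))) (Bd? f d)
          (λ { (refl , ne) → refl , ne ∘ sym }) (λ { (refl , ne) → refl , ne ∘ sym }))))))))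

  -- Reversing darts turns payments into receipts, so both totals are `Σs` and cancel.
  discharged : 4 * F ≤ ∑ darts crossing + ∑ (allFin F) deficit
  discharged = *-cancelˡ-≤ 3 (+-cancelʳ-≤ (∑ (allFin F) (around send)) _ _ (begin
    3 * (4 * F) + Σs
      ≡⟨ cong (_+ Σs) (trans (sym (*-assoc 3 4 F)) (trans (*-comm 12 F) (sym (∑-allFin-const F 12)))) ⟩
    ∑ (allFin F) (λ _ → 12) + Σs
      ≡⟨ ∑-+ (allFin F) _ _ ⟨
    ∑ (allFin F) (λ f → 12 + around send f)
      ≤⟨ ∑-mono (allFin F) charge ⟩
    ∑ (allFin F) (λ f → 3 * len f + around (send ∘ rev) f + 3 * deficit f)
      ≡⟨ ∑-+ (allFin F) _ _ ⟩
    ∑ (allFin F) (λ f → 3 * len f + around (send ∘ rev) f) + ∑ (allFin F) (λ f → 3 * deficit f)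
      ≡⟨ cong₂ _+_ (∑-+ (allFin F) _ _) (∑-* (allFin F) 3 deficit) ⟩
    ∑ (allFin F) (λ f → 3 * len f) + ∑ (allFin F) (around (send ∘ rev)) + 3 * D
      ≡⟨ cong₂ (λ x y → x + y + 3 * D) (trans (∑-* (allFin F) 3 len) (cong (3 *_) lens)) received ⟩
    3 * C + Σs + 3 * D
      ≡⟨ solve 3 (λ c s d → con 3 :* c :+ s :+ con 3 :* d := con 3 :* (c :+ d) :+ s) refl C Σs D ⟩
    3 * (C + D) + Σs ∎))
    where
    open ≤-Reasoning
    open +-*-Solver
    Σs = ∑ (allFin F) (around send)
    C = ∑ darts crossing
    D = ∑ (allFin F) deficit
    lens : ∑ (allFin F) len ≡ C
    lens = trans (∑-cong (allFin F) (λ f → sym (around-1 f)))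
          (trans (∑-around (λ _ → 1)) (∑-cong darts (λ d → *-identityʳ _)))
    received : ∑ (allFin F) (around (send ∘ rev)) ≡ Σs
    received = trans (∑-around (send ∘ rev))
      (trans (∑-cong darts (λ d → cong (_* send (rev d)) (sym (crossing-rev d))))
      (trans (∑-rev (λ d → crossing d * send d)) (sym (∑-around send))))

  not-both : ∀ f → ¬ (len f ≡ 0 × Twin f)
  not-both f (l≡0 , t , _) = contradiction (trans (sym l≡0) t) λ ()

  deficit-tri : ∀ f → Tri f → deficit f ≤ 2
  deficit-tri f t = penalty-right (len f ≟ 0) (twin? f) λ l≡0 → contradiction (trans (sym l≡0) t) λ ()

  -- The two boundary triangles share the edge of `d`. A boundary dart of `f` leading to a third
  -- class would make them different as cycles, which `noTT` forbids. So `f` and `g` are the two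
  -- sides of one triangle.
  twin-cross : ∀ {f g d} → Tri f → Tri g → Bd f d → cls (rev d) ≡ g →
               ∀ x → cls x ≡ f → cls (rev x) ≡ f ⊎ cls (rev x) ≡ g
  twin-cross {f} {g} {d} tf tg b refl x x∈f with cls (rev x) Fin.≟ f | cls (rev x) Fin.≟ g
  ... | yes p | _     = inj₁ p
  ... | no _  | yes q = inj₂ q
  ... | no ¬p | no ¬q = ⊥-elim (noTT (cycle (triangle tf)) (cycle (triangle tg)) different
      (src d , tgt d , edge⁺ (triangle tf) b , oppositeTriangle-edge b tg))
    where
    different : ¬ SameCycle (cycle (triangle tf)) (cycle (triangle tg))
    different same with edge⁻ (triangle tg) {x} (Equivalence.to (same _ _) (edge⁺ (triangle tf) (x∈f , ¬p)))
    ... | inj₁ (x∈g , _) = proj₂ b (trans (sym x∈g) x∈f)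
    ... | inj₂ (x∈g , _) = ¬q x∈g

  twin-closed : ∀ {f d} → Bd f d → Tri f → Tri (cls (rev d)) → let X = λ g → g ≡ f ⊎ g ≡ cls (rev d) in
                ∀ x → X (cls x) → X (cls (rev x))
  twin-closed b t t′ x (inj₁ x∈f) = twin-cross t t′ b refl x x∈f
  twin-closed {f} {d} b@(c , _) t t′ x (inj₂ x∈g) =
    Sum.swap (twin-cross t′ t (opposite b) (trans (cong cls (rev-rev d)) c) x x∈g)

  -- Missing charge in each component

  module _ {C : ℕ} (comps : Classes (Star (Graph._~_ G)) C) where

    comp : Fin n → Fin C
    comp = Classes.class comps

    joined : ∀ {u v} → comp u ≡ comp v → Star (Graph._~_ G) u v
    joined = Equivalence.to (Classes.complete comps _ _)

    isolated? : ∀ v → Dec (Graph.Isolated G v)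
    isolated? = Graph.isolated? G

    home : Fin F → Fin C
    home f = comp (src (proj₁ (rep f)))

    only : (X : Fin F → Set) → (∀ d → X (cls d) → X (cls (rev d))) →
           ∀ {f g} → home f ≡ home g → X f → X g
    only X flip {f} {g} eq x = subst X (proj₂ (rep g))
      (spread X flip (joined eq) (subst X (sym (proj₂ (rep f))) x))

    isolated-only : ∀ {u v} → Graph.Isolated G u → comp u ≡ comp v → u ≡ v
    isolated-only iso eq with joined eq
    ... | ε     = refl
    ... | e ◅ _ = contradiction e (iso _)

    private
      I : Fin n → ℕ
      I v = 4 * ⟦ isolated? v ⟧

      deficits isolateds : Fin C → ℕ
      deficits k = ∑ (allFin F) (λ f → ⟦ home f Fin.≟ k ⟧ * deficit f)
      isolateds k = ∑ (allFin n) (λ v → ⟦ comp v Fin.≟ k ⟧ * I v)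

      split : {P : Set} (p : Dec P) {m : ℕ} → ⟦ p ⟧ * m ≢ 0 → P × m ≢ 0
      split (yes x) h = x , λ { refl → h refl }
      split (no _)  h = contradiction refl h

      deficits-cover : ∀ k fs → (∀ f → home f ≡ k → deficit f ≢ 0 → f ∈ fs) → deficits k ≤ ∑ fs deficit
      deficits-cover k fs cov = ≤-trans
        (∑-cover {ys = fs} _ (allFin⁺ F) (λ {f} _ h → let p , q = split (home f Fin.≟ k) h in cov f p q))
        (∑-mono fs (λ f → ⟦⟧*≤ (home f Fin.≟ k) (deficit f)))

      isolateds-cover : ∀ k vs → (∀ v → comp v ≡ k → Graph.Isolated G v → v ∈ vs) → isolateds k ≤ length vs * 4
      isolateds-cover k vs cov = ≤-trans
        (∑-cover {ys = vs} _ (allFin⁺ n) (λ {v} _ h → let p , q = split (comp v Fin.≟ k) h in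
          cov v p (⟦⟧≢0⇒ (isolated? v) (λ eq → q (cong (4 *_) eq)))))
        (≤-trans (∑-mono vs (λ v → ≤-trans (⟦⟧*≤ (comp v Fin.≟ k) (I v)) (*-monoʳ-≤ 4 (⟦⟧≤1 (isolated? v)))))
                 (≤-reflexive (∑-const vs 4)))

      -- A class with empty boundary, and likewise a pair of twins, is a set of classes that no edge
      -- leaves. By `only` it exhausts the component, which then lacks 4, or 2 for each twin.
      component-deficit : ∀ k → deficits k ≤ 4
      component-deficit k with Fin.any? (λ f → home f Fin.≟ k ×-dec len f ≟ 0)
      ... | yes (f , refl , l≡0) = ≤-trans
        (deficits-cover k (f ∷ []) (λ g g∈k _ → here (only (_≡ f) flip (sym g∈k) refl)))
        (≤-trans (≤-reflexive (+-identityʳ _)) (penalty≤4 (len f ≟ 0) (twin? f) (not-both f)))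
        where
        flip : ∀ d → cls d ≡ f → cls (rev d) ≡ f
        flip d d∈f = decidable-stable (cls (rev d) Fin.≟ f) (λ ne → len≡0⇒ l≡0 (d∈f , ne))
      ... | no noEmpty with Fin.any? (λ f → home f Fin.≟ k ×-dec twin? f)
      ... | yes (f , refl , t , d , b , t′) = ≤-trans
        (deficits-cover k (f ∷ cls (rev d) ∷ []) (λ g g∈k _ → toMem (only _ (twin-closed b t t′) (sym g∈k) (inj₁ refl))))
        (+-mono-≤ (deficit-tri f t) (≤-trans (≤-reflexive (+-identityʳ _)) (deficit-tri _ t′)))
        where
        toMem : ∀ {g} → g ≡ f ⊎ g ≡ cls (rev d) → g ∈ f ∷ cls (rev d) ∷ []
        toMem (inj₁ p) = here p
        toMem (inj₂ q) = there (here q)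
      ... | no noTwin = ≤-trans
        (deficits-cover k [] (λ f f∈k h → ⊥-elim (none f f∈k (penalty≢0 (len f ≟ 0) (twin? f) h)))) z≤n
        where
        none : ∀ f → home f ≡ k → ¬ (len f ≡ 0 ⊎ Twin f)
        none f f∈k (inj₁ l≡0) = noEmpty (f , f∈k , l≡0)
        none f f∈k (inj₂ tw)  = noTwin (f , f∈k , tw)

      -- An isolated vertex is its whole component and carries no dart, so no class has its home
      -- there. Hence the two sums are never both nonzero.
      component-slack : ∀ k → deficits k + isolateds k ≤ 4
      component-slack k with Fin.any? (λ v → comp v Fin.≟ k ×-dec isolated? v)
      ... | yes (v , refl , iso) = +-mono-≤
        (deficits-cover k [] (λ f f∈k _ → ⊥-elim (noFace f f∈k)))
        (isolateds-cover k (v ∷ []) (λ u u∈k _ → here (sym (isolated-only iso (sym u∈k)))))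
        where
        noFace : ∀ f → home f ≢ comp v
        noFace f f∈k = iso _ (subst (λ u → Graph._~_ G u (tgt d)) (sym (isolated-only iso (sym f∈k))) (edge d))
          where d = proj₁ (rep f)
      ... | no none = ≤-trans
        (+-mono-≤ (component-deficit k) (isolateds-cover k [] (λ v v∈k iso → ⊥-elim (none (v , v∈k , iso)))))
        ≤-refl

    deficit-bound : ∑ (allFin F) deficit + 4 * length (filter isolated? (allFin n)) ≤ 4 * C
    deficit-bound = begin
      ∑ (allFin F) deficit + 4 * length (filter isolated? (allFin n))
        ≡⟨ cong (∑ (allFin F) deficit +_) (trans (cong (4 *_) (length-filter≡∑ isolated? (allFin n))) (sym (∑-* (allFin n) 4 _))) ⟩
      ∑ (allFin F) deficit + ∑ (allFin n) I
        ≡⟨ cong₂ _+_ (∑-fibres home (allFin F) deficit) (∑-fibres comp (allFin n) I) ⟩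
      ∑ (allFin C) deficits + ∑ (allFin C) isolateds
        ≡⟨ ∑-+ (allFin C) deficits isolateds ⟨
      ∑ (allFin C) (λ k → deficits k + isolateds k)
        ≤⟨ ∑-mono (allFin C) component-slack ⟩
      ∑ (allFin C) (λ _ → 4)
        ≡⟨ trans (∑-allFin-const C 4) (*-comm C 4) ⟩
      4 * C ∎
      where open ≤-Reasoning

    -- Isolated vertices stay in the estimate because `euler` counts a face for each of them; such a
    -- face behaves like a class with empty boundary and takes the allowance 4 of its component.
    face-bound : 4 * F + 4 * length (filter isolated? (allFin n)) ≤ ∑ darts crossing + 4 * C
    face-bound = begin
      4 * F + 4 * iso                      ≤⟨ +-monoˡ-≤ (4 * iso) discharged ⟩
      ∑ darts crossing + D + 4 * iso       ≡⟨ +-assoc (∑ darts crossing) D (4 * iso) ⟩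
      ∑ darts crossing + (D + 4 * iso)     ≤⟨ +-monoʳ-≤ (∑ darts crossing) deficit-bound ⟩
      ∑ darts crossing + 4 * C             ∎
      where
      open ≤-Reasoning
      iso = length (filter isolated? (allFin n))
      D = ∑ (allFin F) deficit

-- Counting edges of a subgraph

disjoint-cases : {L H S S′ : Set} (l : Dec L) (h : Dec H) (s : Dec S) (s′ : Dec S′) →
  ¬ (H × S) → ¬ (H × S′) → ¬ (S × S′) →
  ⟦ l ×-dec (¬? h ×-dec (¬? s ×-dec ¬? s′)) ⟧ + ⟦ l ⟧ * ⟦ h ⟧ + ⟦ l ⟧ * (⟦ s ⟧ + ⟦ s′ ⟧) ≤ ⟦ l ⟧
disjoint-cases (no _)  _       _       _       _  _  _  = z≤n
disjoint-cases (yes _) (yes a) (yes b) _       ab _  _  = contradiction (a , b) ab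
disjoint-cases (yes _) (yes a) _       (yes c) _  ac _  = contradiction (a , c) ac
disjoint-cases (yes _) _       (yes b) (yes c) _  _  bc = contradiction (b , c) bc
disjoint-cases (yes _) (yes _) (no _)  (no _)  _  _  _  = ≤-refl
disjoint-cases (yes _) (no _)  (yes _) (no _)  _  _  _  = ≤-refl
disjoint-cases (yes _) (no _)  (no _)  (yes _) _  _  _  = ≤-refl
disjoint-cases (yes _) (no _)  (no _)  (no _)  _  _  _  = ≤-refl

module Subgraph {n} {G : Graph n} (planar : Planar G) (H : Sub n) (H⊆G : IsSubgraph G H)
                {v₀ : Fin n} (v₀∈H : v₀ Subset.∈ Sub.vertices H) where

  open Graph G using (_~_; adj)
  open Planar planar
  open Sub H
  open IsSubgraph H⊆G
  open Darts G

  comp : Fin n → Fin componentCount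
  comp = Classes.class components

  base : Fin componentCount → Fin n
  base k = proj₁ (Classes.surjective components k)

  comp-base : ∀ k → comp (base k) ≡ k
  comp-base k = proj₂ (Classes.surjective components k) refl

  -- Roots of the spanning forest: the vertices of `H`, and a base in each component so that
  -- everything is reached. The component of `v₀` already has the root `v₀`; leaving out its base
  -- saves the 1 on which the strict inequality rests.
  R : Fin n → Set
  R v = v Subset.∈ vertices ⊎ (base (comp v) ≡ v × comp v ≢ comp v₀)

  R? : Decidable R
  R? v = v Subset.∈? vertices ⊎-dec (base (comp v) Fin.≟ v ×-dec ¬? (comp v Fin.≟ comp v₀))

  abstract
    forest : ∃ (Closed {E = _~_} (λ u v → T? (adj u v)) R?)
    forest = closedForest (λ u v → T? (adj u v)) R?

  open SearchForest (proj₁ forest)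

  along : ∀ {u w} → Star _~_ u w → X u → X w
  along ε       x = x
  along (e ◅ p) x = along p (proj₂ forest x e)

  reached : ∀ v → X v
  reached v with comp v Fin.≟ comp v₀
  ... | yes eq = along (Equivalence.to (Classes.complete components _ _) (sym eq)) (root (inj₁ v₀∈H))
  ... | no ne = along (Equivalence.to (Classes.complete components _ _) same) (root (inj₂ (cong base same , ne′)))
    where
    same : comp (base (comp v)) ≡ comp v
    same = comp-base (comp v)
    ne′ : comp (base (comp v)) ≢ comp v₀
    ne′ eq = ne (trans (sym same) eq)

  InH Tree : Dart G → Set
  InH d  = T (entry (src d) (tgt d))
  Tree d = ¬ R (src d) × par (src d) ≡ tgt d

  inH? : ∀ d → Dec (InH d)
  inH? d = T? (entry (src d) (tgt d))

  tree? : ∀ d → Dec (Tree d)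
  tree? d = ¬? (R? (src d)) ×-dec par (src d) Fin.≟ tgt d

  up? : (d : Dart G) → Dec (src d Fin.< tgt d)
  up? d = src d Fin.<? tgt d

  InH⇒R : ∀ d → InH d → R (src d) × R (tgt d)
  InH⇒R d h = inj₁ (endpoint _ _ h) , inj₁ (endpoint _ _ (entry-sym _ _ h))

  tree-rank : ∀ {d} → Tree d → rank (tgt d) ℕ.< rank (src d)
  tree-rank {d} (¬r , refl) = proj₂ (proj₂ (parent (reached (src d)) ¬r))

  Cut : Dart G → Set
  Cut d = src d Fin.< tgt d × ¬ InH d × ¬ Tree d × ¬ Tree (rev d)

  cut? : Decidable Cut
  cut? d = up? d ×-dec (¬? (inH? d) ×-dec (¬? (tree? d) ×-dec ¬? (tree? (rev d))))

  cuts : List (Dart G)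
  cuts = filter cut? darts

  tree-count : ∑ (allFin n) (λ v → ⟦ ¬? (R? v) ⟧) ≤ ∑ darts (λ d → ⟦ tree? d ⟧)
  tree-count = ≤-trans (∑-mono (allFin n) step) (≤-reflexive (sym (∑-fibres src darts _)))
    where
    step : ∀ v → ⟦ ¬? (R? v) ⟧ ≤ ∑ darts (λ d → ⟦ src d Fin.≟ v ⟧ * ⟦ tree? d ⟧)
    step v = go (¬? (R? v))
      where
      go : (r : Dec (¬ R v)) → ⟦ r ⟧ ≤ ∑ darts (λ d → ⟦ src d Fin.≟ v ⟧ * ⟦ tree? d ⟧)
      go (no _)   = z≤n
      go (yes ¬r) = ≤-trans (≤-reflexive (sym (cong₂ _*_ (⟦⟧-yes (v Fin.≟ v) refl) (⟦⟧-yes (tree? d) (¬r , refl)))))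
                            (∈⇒≤∑ (λ d → ⟦ src d Fin.≟ v ⟧ * ⟦ tree? d ⟧) (∈-darts d))
        where d = dart v (par v) (Graph.sym G (proj₁ (proj₂ (parent (reached v) ¬r))))

  -- The three kinds of edges are disjoint. Both ends of an edge of `H` are roots, whereas a tree
  -- dart starts at a non-root; and since ranks drop along tree darts, no edge is a tree edge in
  -- both directions. Every non-root owns one tree edge.
  edge-split : length cuts + edgeCount entry + ∑ (allFin n) (λ v → ⟦ ¬? (R? v) ⟧) ≤ edgeCount adj
  edge-split = begin
    length cuts + edgeCount entry + ∑ (allFin n) (λ v → ⟦ ¬? (R? v) ⟧)
      ≤⟨ +-mono-≤ (≤-reflexive (cong₂ _+_ (length-filter≡∑ cut? darts) (edgeCount≡∑ entry ⊆-edges)))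
                  (≤-trans tree-count (≤-reflexive (sym (∑-up (λ d → ⟦ tree? d ⟧))))) ⟩
    ∑ darts c + ∑ darts h + ∑ darts t
      ≡⟨ cong (_+ ∑ darts t) (∑-+ darts c h) ⟨
    ∑ darts (λ d → c d + h d) + ∑ darts t
      ≡⟨ ∑-+ darts (λ d → c d + h d) t ⟨
    ∑ darts (λ d → c d + h d + t d)
      ≤⟨ ∑-mono darts (λ d → disjoint-cases (up? d) (inH? d) (tree? d) (tree? (rev d))
           (λ (a , b) → proj₁ b (proj₁ (InH⇒R d a)))
           (λ (a , b) → proj₁ b (proj₂ (InH⇒R d a)))
           (λ (a , b) → <-asym (tree-rank {d} a) (tree-rank {rev d} b))) ⟩
    ∑ darts up
      ≡⟨ ∑-cong darts (λ d → trans (sym (*-identityʳ (up d)))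
           (cong (up d *_) (sym (⟦⟧-yes (T? (adj (src d) (tgt d))) (edge d))))) ⟩
    ∑ darts (λ d → up d * ⟦ T? (adj (src d) (tgt d)) ⟧)
      ≡⟨ edgeCount≡∑ adj (λ _ _ e → e) ⟨
    edgeCount adj ∎
    where
    open ≤-Reasoning
    c h t : Dart G → ℕ
    c d = ⟦ cut? d ⟧
    h d = up d * ⟦ inH? d ⟧
    t d = up d * (⟦ tree? d ⟧ + ⟦ tree? (rev d) ⟧)

  face-onto : ∀ f → ∃ λ d → Classes.class faces d ≡ f
  face-onto f = let d , p = Classes.surjective faces f in d , p refl

  abstract
    gluing : Gluing (Classes.class faces) (map (λ d → d , rev d) cuts)
    gluing = glueing (Classes.class faces) face-onto (map (λ d → d , rev d) cuts)

  open Gluing gluing renaming (cls′ to cls; size to F; bound to gluing-bound; onto to cls-onto)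

  faces-bound : faceCount ≤ F + length cuts
  faces-bound = subst (λ m → faceCount ≤ F + m) (List.length-map _ cuts) gluing-bound

  open Rotation rotation using (perm; fix; cyclic)

  cls-rot : ∀ d → cls (Inverse.to perm d) ≡ cls (rev d)
  cls-rot d = coarser (sym (Equivalence.from (Classes.complete faces (rev d) (Inverse.to perm d))
    (cong (Inverse.to perm) (rev-rev d) ◅ ε)))

  Flat : Dart G → Set
  Flat d = cls d ≡ cls (rev d)

  flat-rev : ∀ {d} → Flat (rev d) → Flat d
  flat-rev {d} eq = trans (cong cls (sym (rev-rev d))) (sym eq)

  cut-flat : ∀ d → ¬ InH d → ¬ Tree d → ¬ Tree (rev d) → Flat d
  cut-flat d ¬h ¬t ¬t′ with Fin.<-cmp (src d) (tgt d)
  ... | tri< lt _ _ = glued (∈-map⁺ (λ d → d , rev d) (∈-filter⁺ cut? (∈-darts d) (lt , ¬h , ¬t , ¬t′)))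
  ... | tri≈ _ eq _ = contradiction eq (src≢tgt d)
  ... | tri> _ _ gt = flat-rev (glued (∈-map⁺ (λ d → d , rev d) (∈-filter⁺ cut? (∈-darts (rev d))
    (gt , ¬h ∘ entry-sym _ _ , ¬t′ , ¬t ∘ subst Tree (rev-rev d)))))

  -- Turning about the source of `d`, from its successor back to `d`, passes only edges with equal
  -- classes on both sides. So the class at the beginning, that of `rev d`, equals the class at the
  -- end, that of `d`.
  fan : ∀ {d} → (∀ e → src e ≡ src d → e ≢ d → Flat e) → Flat d
  fan {d} flat = sym (trans (sym (cls-rot d)) (turn (fix d) (cyclic (Inverse.to perm d) d (fix d))))
    where
    turn : ∀ {e} → src e ≡ src d → Orbit (Inverse.to perm) e d → cls e ≡ cls d
    turn     s ε          = refl
    turn {e} s (refl ◅ o) with e ≟ᵈ d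
    ... | yes refl = refl
    ... | no e≢d   = trans (flat e s e≢d) (trans (sym (cls-rot e)) (turn (trans (fix e) s) o))

  -- Every other edge at v is cut or leads to a child of v, so the two sides of
  -- the edge to the parent of v are glued already; induction on height ∸ rank.
  tree-flat : ∀ m d → Tree d → height ≤ m + rank (src d) → Flat d
  tree-flat zero    d t le = contradiction (low (reached (src d))) (≤⇒≯ le)
  tree-flat (suc m) d t@(¬r , p) le = fan other
    where
    other : ∀ e → src e ≡ src d → e ≢ d → Flat e
    other e s e≢d = go (tree? (rev e))
      where
      ¬h : ¬ InH e
      ¬h h = ¬r (subst R s (proj₁ (InH⇒R e h)))
      ¬t : ¬ Tree e
      ¬t (_ , q) = e≢d (dart-≡ s (trans (sym q) (trans (cong par s) p)))
      go : Dec (Tree (rev e)) → Flat e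
      go (no ¬t′) = cut-flat e ¬h ¬t ¬t′
      go (yes t′) = flat-rev (tree-flat m (rev e) t′ (≤-trans le
        (≤-trans (≤-reflexive (sym (+-suc m (rank (src d))))) (+-monoʳ-≤ m (subst (λ v → rank v ℕ.< rank (tgt e)) s (tree-rank {rev e} t′))))))

  -- Only darts of `H` can separate two classes, so at most 2e darts are crossing, although no pair
  -- was spent on the tree edges.
  flat : ∀ d → ¬ InH d → Flat d
  flat d ¬h = go (tree? d) (tree? (rev d))
    where
    go : Dec (Tree d) → Dec (Tree (rev d)) → Flat d
    go (yes t) _        = tree-flat height d t (m≤m+n height _)
    go (no _)  (yes t′) = flat-rev (tree-flat height (rev d) t′ (m≤m+n height _))
    go (no ¬t) (no ¬t′) = cut-flat d ¬h ¬t ¬t′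

  root-count : suc n ≤ ∑ (allFin n) (λ v → ⟦ ¬? (R? v) ⟧) + (∣ vertices ∣ + componentCount)
  root-count = begin
    suc n
      ≡⟨ cong suc (trans (sym (*-identityʳ n)) (sym (∑-allFin-const n 1))) ⟩
    suc (∑ (allFin n) (λ _ → 1))
      ≤⟨ s≤s (∑-mono (allFin n) (λ v → pointwise v (R? v))) ⟩
    suc (∑ (allFin n) (λ v → ⟦ ¬? (R? v) ⟧ + (⟦ v Subset.∈? vertices ⟧ + b v)))
      ≡⟨ cong suc (trans (∑-+ (allFin n) _ _) (cong (N +_) (trans (∑-+ (allFin n) _ _)
           (cong (_+ ∑ (allFin n) b) (sym (∣∣≡∑ vertices)))))) ⟩
    suc (N + (∣ vertices ∣ + ∑ (allFin n) b))
      ≡⟨ trans (sym (+-suc N _)) (cong (N +_) (sym (+-suc ∣ vertices ∣ _))) ⟩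
    N + (∣ vertices ∣ + suc (∑ (allFin n) b))
      ≤⟨ +-monoʳ-≤ N (+-monoʳ-≤ ∣ vertices ∣ bases) ⟩
    N + (∣ vertices ∣ + componentCount) ∎
    where
    open ≤-Reasoning
    N = ∑ (allFin n) (λ v → ⟦ ¬? (R? v) ⟧)
    b? : ∀ v → Dec (base (comp v) ≡ v × comp v ≢ comp v₀)
    b? v = base (comp v) Fin.≟ v ×-dec ¬? (comp v Fin.≟ comp v₀)
    b : Fin n → ℕ
    b v = ⟦ b? v ⟧
    pointwise : ∀ v (r : Dec (R v)) → 1 ≤ ⟦ ¬? r ⟧ + (⟦ v Subset.∈? vertices ⟧ + b v)
    pointwise v (no _)         = s≤s z≤n
    pointwise v (yes (inj₁ p)) = ≤-trans (≤-reflexive (sym (⟦⟧-yes (v Subset.∈? vertices) p))) (m≤m+n _ (b v))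
    pointwise v (yes (inj₂ q)) = ≤-trans (≤-reflexive (sym (⟦⟧-yes (b? v) q))) (m≤n+m (b v) ⟦ v Subset.∈? vertices ⟧)

    -- The component of v₀ has no base among the roots.
    perComponent : ∀ k → ⟦ comp v₀ Fin.≟ k ⟧ + ∑ (allFin n) (λ v → ⟦ comp v Fin.≟ k ⟧ * b v) ≤ 1
    perComponent k = go (comp v₀ Fin.≟ k)
      where
      go : (q : Dec (comp v₀ ≡ k)) → ⟦ q ⟧ + ∑ (allFin n) (λ v → ⟦ comp v Fin.≟ k ⟧ * b v) ≤ 1
      go (yes refl) = s≤s (∑-cover {ys = []} _ (allFin⁺ n) λ {v} _ h →
        ⊥-elim (proj₂ (⟦⟧*≢0⇒ (b? v) (λ eq → h (trans (*-comm ⟦ comp v Fin.≟ k ⟧ (b v)) eq))) (⟦⟧*≢0⇒ (comp v Fin.≟ k) h)))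
      go (no _) = begin
        ∑ (allFin n) (λ v → ⟦ comp v Fin.≟ k ⟧ * b v)
          ≤⟨ ∑-cover {ys = base k ∷ []} _ (allFin⁺ n) (λ {v} _ h → here
               (trans (sym (proj₁ (⟦⟧*≢0⇒ (b? v) (λ eq → h (trans (*-comm ⟦ comp v Fin.≟ k ⟧ (b v)) eq)))))
                      (cong base (⟦⟧*≢0⇒ (comp v Fin.≟ k) h)))) ⟩
        ⟦ comp (base k) Fin.≟ k ⟧ * b (base k) + 0
          ≡⟨ +-identityʳ _ ⟩
        ⟦ comp (base k) Fin.≟ k ⟧ * b (base k)
          ≤⟨ ⟦⟧*≤ (comp (base k) Fin.≟ k) (b (base k)) ⟩
        b (base k)
          ≤⟨ ⟦⟧≤1 (b? (base k)) ⟩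
        1 ∎

    bases : suc (∑ (allFin n) b) ≤ componentCount
    bases = begin
      1 + ∑ (allFin n) b
        ≡⟨ cong₂ _+_ (sym (∑-allFin-≟ (comp v₀))) (∑-fibres comp (allFin n) b) ⟩
      ∑ (allFin componentCount) (λ k → ⟦ comp v₀ Fin.≟ k ⟧)
        + ∑ (allFin componentCount) (λ k → ∑ (allFin n) (λ v → ⟦ comp v Fin.≟ k ⟧ * b v))
        ≡⟨ ∑-+ (allFin componentCount) _ _ ⟨
      ∑ (allFin componentCount) (λ k → ⟦ comp v₀ Fin.≟ k ⟧ + ∑ (allFin n) (λ v → ⟦ comp v Fin.≟ k ⟧ * b v))
        ≤⟨ ∑-mono (allFin componentCount) perComponent ⟩
      ∑ (allFin componentCount) (λ _ → 1)
        ≡⟨ trans (∑-allFin-const componentCount 1) (*-identityʳ componentCount) ⟩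
      componentCount ∎

  module _ (noTT : NoTriangleAdjacentToTriangle G) (noT4 : NoTriangleAdjacentTo4Cycle G)
           (five : 5CyclesAdjacentToAtMost3Triangles G) where

    open Discharging rotation cls cls-rot cls-onto noTT noT4 five using (crossing; face-bound)

    crossing-bound : ∑ darts crossing ≤ 2 * edgeCount entry
    crossing-bound = ≤-trans
      (∑-mono darts (λ d → ⟦⟧-mono (¬? (cls d Fin.≟ cls (rev d))) (inH? d)
        (λ ne → decidable-stable (inH? d) (λ ¬h → ne (flat d ¬h)))))
      (≤-reflexive (sym (2*edgeCount≡∑ entry entry-sym ⊆-edges)))

    edge-bound : edgeCount entry ℕ.< 2 * ∣ vertices ∣
    edge-bound = arithmetic n faceCount _ (edgeCount adj) componentCount (length cuts) _ _ F _
      euler root-count faces-bound edge-split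
      (≤-trans (face-bound components) (+-monoˡ-≤ (4 * componentCount) crossing-bound))
      where
      open ≤-Reasoning
      open +-*-Solver
      arithmetic : ∀ n f i e c s eH N F vH →
        n + (f + i) ≡ e + 2 * c → suc n ≤ N + (vH + c) → f ≤ F + s → s + eH + N ≤ e →
        4 * F + 4 * i ≤ 2 * eH + 4 * c → eH ℕ.< 2 * vH
      arithmetic n f i e c s eH N F vH eul roots glu spl dis =
        *-cancelˡ-≤ 2 (≤-trans (≤-reflexive (*-suc 2 eH)) (≤-trans (+-monoˡ-≤ (2 * eH) (from-yes (2 ≤? 4))) half))
        where
        -- What Euler's formula for `G` leaves for `H`: the cut edges cancel against the lost faces,
        -- and the tree edges against the non-roots.
        first : 1 + eH + c ≤ vH + F + i
        first = +-cancelˡ-≤ (s + N + c) _ _ (begin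
          s + N + c + (1 + eH + c)
            ≡⟨ solve 4 (λ s N c eH → s :+ N :+ c :+ (con 1 :+ eH :+ c) := con 1 :+ (s :+ eH :+ N :+ con 2 :* c)) refl s N c eH ⟩
          1 + (s + eH + N + 2 * c)     ≤⟨ s≤s (+-monoˡ-≤ (2 * c) spl) ⟩
          1 + (e + 2 * c)              ≡⟨ cong suc (sym eul) ⟩
          suc n + (f + i)              ≤⟨ +-mono-≤ roots (+-monoˡ-≤ i glu) ⟩
          N + (vH + c) + (F + s + i)
            ≡⟨ solve 6 (λ N vH c F s i → N :+ (vH :+ c) :+ (F :+ s :+ i) := s :+ N :+ c :+ (vH :+ F :+ i)) refl N vH c F s i ⟩
          s + N + c + (vH + F + i)     ∎)
        -- Four times `first`, combined with the face bound. This is e + 2 ≤ 2v, from which the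
        -- strict inequality is obtained by weakening 4 to 2.
        half : 4 + 2 * eH ≤ 2 * (2 * vH)
        half = +-cancelˡ-≤ (2 * eH + 4 * c) _ _ (begin
          2 * eH + 4 * c + (4 + 2 * eH)
            ≡⟨ solve 2 (λ eH c → con 2 :* eH :+ con 4 :* c :+ (con 4 :+ con 2 :* eH) := con 4 :* (con 1 :+ eH :+ c)) refl eH c ⟩
          4 * (1 + eH + c)             ≤⟨ *-monoʳ-≤ 4 first ⟩
          4 * (vH + F + i)
            ≡⟨ solve 3 (λ vH F i → con 4 :* (vH :+ F :+ i) := con 4 :* F :+ con 4 :* i :+ con 4 :* vH) refl vH F i ⟩
          4 * F + 4 * i + 4 * vH       ≤⟨ +-monoˡ-≤ (4 * vH) dis ⟩
          2 * eH + 4 * c + 4 * vH      ≡⟨ cong (2 * eH + 4 * c +_) (*-assoc 2 2 vH) ⟩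
          2 * eH + 4 * c + 2 * (2 * vH) ∎)

-- Orientations of sparse graphs

module _ (_≟_ : DecidableEquality A) where

  pick : {xs ys : List A} → Unique xs → length ys ℕ.< length xs → ∃ λ x → x ∈ xs × x ∉ ys
  pick {xs} {ys} uniq lt with any? (λ x → ¬? (DecMembership._∈?_ _≟_ x ys)) xs
  ... | yes some = find some
  ... | no none  = contradiction (unique-length uniq λ {x} x∈ →
    decidable-stable (DecMembership._∈?_ _≟_ x ys) (λ x∉ → none (lose x∈ x∉))) (<⇒≱ lt)

-- The vertex `v` only witnesses that the subgraph is not null, where the strict inequality would
-- fail.
Sparse : Graph n → Set
Sparse {n} G = (H : Sub n) → IsSubgraph G H → ∀ {v} → v Subset.∈ Sub.vertices H →
               edgeCount (Sub.entry H) ℕ.< 2 * ∣ Sub.vertices H ∣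

dec-does : {P : Set} (p : Dec P) → does p ≡ Bool.true → P
dec-does (yes x) _ = x

module _ {X : Fin n → Set} (X? : Decidable X) where

  subset : Subset.Subset n
  subset = tabulate (λ v → does (X? v))

  ∈-subset⁺ : ∀ {v} → X v → v Subset.∈ subset
  ∈-subset⁺ {v} x = Vec.lookup⇒[]= v subset (trans (Vec.lookup∘tabulate _ v) (dec-true (X? v) x))

  ∈-subset⁻ : ∀ {v} → v Subset.∈ subset → X v
  ∈-subset⁻ {v} v∈ = dec-does (X? v) (trans (sym (Vec.lookup∘tabulate _ v)) (Vec.[]=⇒lookup v∈))

module _ (X : Fin n → Set) (X? : Decidable X) (E : Fin n → Fin n → Set) (E? : ∀ u v → Dec (E u v)) where

  mkSub : Sub n
  mkSub = sub (subset X?) (tabulate (λ u → subset (E? u)))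

  entry⁺ : ∀ {u v} → E u v → T (Sub.entry mkSub u v)
  entry⁺ {u} {v} e rewrite Vec.lookup∘tabulate (λ u → subset (E? u)) u =
    Bool.T-≡ .Equivalence.from (Vec.[]=⇒lookup (∈-subset⁺ (E? u) e))

  entry⁻ : ∀ {u v} → T (Sub.entry mkSub u v) → E u v
  entry⁻ {u} {v} t rewrite Vec.lookup∘tabulate (λ u → subset (E? u)) u =
    ∈-subset⁻ (E? u) (Vec.lookup⇒[]= v (subset (E? u)) (Bool.T-≡ .Equivalence.to t))

module Orienting {n} (G : Graph n) where

  open Graph G using (_~_; adj)
  open Darts G

  record Orientation : Set₁ where
    field
      O    : Dart G → Set
      O?   : Decidable O
      asym : ∀ {d} → O d → ¬ O (rev d)

    Oriented : Dart G → Set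
    Oriented d = O d ⊎ O (rev d)

    out? : ∀ v d → Dec (src d ≡ v × O d)
    out? v d = src d Fin.≟ v ×-dec O? d

    out : Fin n → ℕ
    out v = ∑ darts (λ d → ⟦ out? v d ⟧)

    Arc : Fin n → Fin n → Set
    Arc u v = Σ (u ~ v) λ e → O (dart u v e)

    arc? : ∀ u v → Dec (Arc u v)
    arc? u v with T? (adj u v)
    ... | no ¬e = no (¬e ∘ proj₁)
    ... | yes e = map′ (e ,_) (λ (e′ , o) → subst O (dart-≡ refl refl) o) (O? (dart u v e))

  open Orientation

  -- Only the set of oriented edges is compared, not their directions, so reversing a dart is
  -- allowed.
  _⊑_ : Orientation → Orientation → Set
  o ⊑ o′ = ∀ d → Oriented o d → Oriented o′ d

  out-mono : ∀ o o′ v → (∀ {d} → src d ≡ v → O o′ d → O o d) → out o′ v ≤ out o v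
  out-mono o o′ v h = ∑-mono darts (λ d → ⟦⟧-mono (out? o′ v d) (out? o v d) (λ (p , q) → p , h p q))

  out-mono+1 : ∀ o o′ v d₀ → (∀ {d} → src d ≡ v → O o′ d → d₀ ≡ d ⊎ O o d) → out o′ v ≤ suc (out o v)
  out-mono+1 o o′ v d₀ h = begin
    out o′ v
      ≤⟨ ∑-mono darts (λ d → step d (out? o′ v d)) ⟩
    ∑ darts (λ d → ⟦ d₀ ≟ᵈ d ⟧ + ⟦ out? o v d ⟧)
      ≡⟨ ∑-+ darts _ _ ⟩
    ∑ darts (λ d → ⟦ d₀ ≟ᵈ d ⟧) + out o v
      ≡⟨ cong (_+ out o v) (∑-≟ _≟ᵈ_ darts-unique (∈-darts d₀)) ⟩
    suc (out o v) ∎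
    where
    open ≤-Reasoning
    step : ∀ d (p : Dec (src d ≡ v × O o′ d)) → ⟦ p ⟧ ≤ ⟦ d₀ ≟ᵈ d ⟧ + ⟦ out? o v d ⟧
    step d (no _) = z≤n
    step d (yes (p , q)) with h p q
    ... | inj₁ eq = ≤-trans (≤-reflexive (sym (⟦⟧-yes (d₀ ≟ᵈ d) eq))) (m≤m+n _ _)
    ... | inj₂ q′ = ≤-trans (≤-reflexive (sym (⟦⟧-yes (out? o v d) (p , q′)))) (m≤n+m ⟦ out? o v d ⟧ ⟦ d₀ ≟ᵈ d ⟧)

  out-drop : ∀ o o′ d₀ → O o d₀ → ¬ O o′ d₀ → (∀ {d} → src d ≡ src d₀ → O o′ d → O o d) →
             suc (out o′ (src d₀)) ≤ out o (src d₀)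
  out-drop o o′ d₀ o₀ ¬o₀ h = begin
    1 + out o′ v
      ≡⟨ cong (_+ out o′ v) (∑-≟ _≟ᵈ_ darts-unique (∈-darts d₀)) ⟨
    ∑ darts (λ d → ⟦ d₀ ≟ᵈ d ⟧) + out o′ v
      ≡⟨ ∑-+ darts _ _ ⟨
    ∑ darts (λ d → ⟦ d₀ ≟ᵈ d ⟧ + ⟦ out? o′ v d ⟧)
      ≤⟨ ∑-mono darts (λ d → step d (d₀ ≟ᵈ d)) ⟩
    out o v ∎
    where
    open ≤-Reasoning
    v = src d₀
    step : ∀ d (p : Dec (d₀ ≡ d)) → ⟦ p ⟧ + ⟦ out? o′ v d ⟧ ≤ ⟦ out? o v d ⟧
    step d (yes refl) = ≤-trans (≤-reflexive (cong suc (⟦⟧-no (out? o′ v d) (¬o₀ ∘ proj₂))))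
                                (≤-reflexive (sym (⟦⟧-yes (out? o v d) (refl , o₀))))
    step d (no _)     = ⟦⟧-mono (out? o′ v d) (out? o v d) (λ (p , q) → p , h p q)

  rev≢ : ∀ d → d ≢ rev d
  rev≢ d eq = src≢tgt d (cong src eq)

  flip : (o : Orientation) (d₀ : Dart G) → O o d₀ → Orientation
  flip o d₀ o₀ = record
    { O    = λ d → d ≡ rev d₀ ⊎ (d ≢ d₀ × O o d)
    ; O?   = λ d → d ≟ᵈ rev d₀ ⊎-dec (¬? (d ≟ᵈ d₀) ×-dec O? o d)
    ; asym = as
    }
    where
    as : ∀ {d} → d ≡ rev d₀ ⊎ (d ≢ d₀ × O o d) → ¬ (rev d ≡ rev d₀ ⊎ (rev d ≢ d₀ × O o (rev d)))
    as (inj₁ refl)     (inj₁ eq)       = rev≢ (rev d₀) (sym eq)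
    as (inj₁ refl)     (inj₂ (ne , _)) = ne (rev-rev d₀)
    as (inj₂ (ne , _)) (inj₁ eq)       = ne (trans (sym (rev-rev _)) (trans (cong rev eq) (rev-rev d₀)))
    as (inj₂ (_ , p))  (inj₂ (_ , q))  = asym o p q

  flip-⊑ : ∀ o d₀ o₀ → o ⊑ flip o d₀ o₀
  flip-⊑ o d₀ o₀ d (inj₁ p) with d ≟ᵈ d₀
  ... | yes refl = inj₂ (inj₁ refl)
  ... | no ne    = inj₁ (inj₂ (ne , p))
  flip-⊑ o d₀ o₀ d (inj₂ q) with rev d ≟ᵈ d₀
  ... | yes refl = inj₁ (inj₁ (sym (rev-rev d)))
  ... | no ne    = inj₂ (inj₂ (ne , q))

  insert : (o : Orientation) (d₀ : Dart G) → ¬ Oriented o d₀ → Orientation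
  insert o d₀ new = record
    { O    = λ d → d ≡ d₀ ⊎ O o d
    ; O?   = λ d → d ≟ᵈ d₀ ⊎-dec O? o d
    ; asym = as
    }
    where
    as : ∀ {d} → d ≡ d₀ ⊎ O o d → ¬ (rev d ≡ d₀ ⊎ O o (rev d))
    as {d} (inj₁ refl) (inj₁ eq)   = rev≢ d (sym eq)
    as (inj₁ refl)     (inj₂ q)    = new (inj₂ q)
    as {d} (inj₂ p)    (inj₁ refl) = new (inj₂ (subst (O o) (sym (rev-rev d)) p))
    as (inj₂ p)        (inj₂ q)    = asym o p q

  Balanced : Orientation → Set
  Balanced o = ∀ v → out o v ≤ 2

  BalancedBut : Fin n → Orientation → Set
  BalancedBut u o = out o u ≤ 3 × (∀ v → v ≢ u → out o v ≤ 2)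

  -- Moving an excess along a directed path

  module _ (rank : Fin n → ℕ) (w : Fin n) where

    data Path (o : Orientation) : ℕ → Fin n → Set where
      stop : Path o 0 w
      step : ∀ {m} d → O o d → rank (src d) ℕ.< rank (tgt d) → Path o m (tgt d) → Path o (suc m) (src d)

    path-rank : ∀ {o m u} → Path o m u → rank u ≤ rank w
    path-rank stop            = ≤-refl
    path-rank (step d _ lt p) = ≤-trans (<⇒≤ lt) (path-rank p)

    path-flip : ∀ {o d₀} (o₀ : O o d₀) {m u} → rank (src d₀) ℕ.< rank u → Path o m u → Path (flip o d₀ o₀) m u
    path-flip o₀ lt stop             = stop
    path-flip o₀ lt (step d o lt′ p) = step d (inj₂ ((λ { refl → <-irrefl refl lt }) , o)) lt′ (path-flip o₀ (<-trans lt lt′) p)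

    -- Ranks increase along the path, so reversing its first dart does not
    -- affect the others.
    push : ∀ {m u} o → Path o m u → BalancedBut u o → (u ≢ w → out o w ≤ 1) → (u ≡ w → out o u ≤ 2) →
           ∃ λ o′ → o ⊑ o′ × Balanced o′
    push o stop (_ , others) _ end = o , (λ _ p → p) , balanced
      where
      balanced : Balanced o
      balanced v with v Fin.≟ w
      ... | yes refl = end refl
      ... | no ne    = others v ne
    push o (step d o₀ lt p) (three , others) low _ =
      let o″ , o′⊑o″ , bal = push o′ (path-flip o₀ lt p) (atHead , elsewhere) low′ end in
      o″ , (λ e → o′⊑o″ e ∘ flip-⊑ o d o₀ e) , bal
      where
      o′ : Orientation
      o′ = flip o d o₀
      at≢ : ∀ {v} → v ≢ tgt d → ∀ {e} → src e ≡ v → O o′ e → O o e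
      at≢ ne s (inj₁ refl)    = contradiction (sym s) ne
      at≢ ne s (inj₂ (_ , q)) = q
      gain : out o′ (tgt d) ≤ suc (out o (tgt d))
      gain = out-mono+1 o o′ (tgt d) (rev d) λ { _ (inj₁ eq) → inj₁ (sym eq) ; _ (inj₂ (_ , q)) → inj₂ q }
      atHead : out o′ (tgt d) ≤ 3
      atHead = ≤-trans gain (s≤s (others (tgt d) (src≢tgt d ∘ sym)))
      elsewhere : ∀ v → v ≢ tgt d → out o′ v ≤ 2
      elsewhere v ne with v Fin.≟ src d
      ... | yes refl = s≤s⁻¹ (≤-trans (out-drop o o′ d o₀ (λ { (inj₁ eq) → rev≢ d eq ; (inj₂ (ne , _)) → ne refl }) (at≢ ne)) three)
      ... | no v≢u   = ≤-trans (out-mono o o′ v (at≢ ne)) (others v v≢u)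
      -- At least one dart remains to be followed, so `w` has larger rank than the source of `d` and
      -- differs from it.
      w-low : out o w ≤ 1
      w-low = low λ { refl → <-irrefl refl (≤-trans lt (path-rank p)) }
      low′ : tgt d ≢ w → out o′ w ≤ 1
      low′ ne = ≤-trans (out-mono o o′ w (at≢ (ne ∘ sym))) w-low
      end : tgt d ≡ w → out o′ (tgt d) ≤ 2
      end refl = ≤-trans gain (s≤s w-low)

  module _ (sparse : Sparse G) where

    -- Take as subgraph the vertices of `X` with all edges oriented out of them; closedness keeps
    -- both ends in `X`. Each edge is counted at its tail only, so there are at least twice as many
    -- edges as vertices.
    dense-absurd : ∀ o {X : Fin n → Set} (X? : Decidable X) {u : Fin n} → X u →
                   (∀ {u v} → X u → Arc o u v → X v) → (∀ v → X v → 2 ≤ out o v) → ⊥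
    dense-absurd o {X} X? {u} Xu closed dense = <-irrefl refl (begin-strict
      edgeCount (Sub.entry H)
        <⟨ sparse H H⊆G (∈-subset⁺ X? Xu) ⟩
      2 * ∣ Sub.vertices H ∣
        ≡⟨ cong (2 *_) (trans (∣∣≡∑ (subset X?)) (∑-cong (allFin n) (λ v → ⟦⟧-cong (v Subset.∈? subset X?) (X? v) (∈-subset⁻ X?) (∈-subset⁺ X?)))) ⟩
      2 * ∑ (allFin n) (λ v → ⟦ X? v ⟧)
        ≡⟨ trans (∑-cong (allFin n) (λ v → *-comm ⟦ X? v ⟧ 2)) (∑-* (allFin n) 2 (λ v → ⟦ X? v ⟧)) ⟨
      ∑ (allFin n) (λ v → ⟦ X? v ⟧ * 2)
        ≤⟨ ∑-mono (allFin n) (λ v → enough v (X? v)) ⟩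
      ∑ (allFin n) (λ v → ∑ darts (λ d → ⟦ src d Fin.≟ v ⟧ * ⟦ f? d ⟧))
        ≡⟨ ∑-fibres src darts (λ d → ⟦ f? d ⟧) ⟨
      ∑ darts (λ d → ⟦ f? d ⟧)
        ≡⟨ ∑-up (λ d → ⟦ f? d ⟧) ⟨
      ∑ darts (λ d → up d * (⟦ f? d ⟧ + ⟦ f? (rev d) ⟧))
        ≤⟨ ∑-mono darts (λ d → *-monoʳ-≤ (up d) (once d (f? d) (f? (rev d)))) ⟩
      ∑ darts (λ d → up d * ⟦ T? (Sub.entry H (src d) (tgt d)) ⟧)
        ≡⟨ edgeCount≡∑ (Sub.entry H) (IsSubgraph.⊆-edges H⊆G) ⟨
      edgeCount (Sub.entry H) ∎)
      where
      open ≤-Reasoning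
      E : Fin n → Fin n → Set
      E u v = (X u × Arc o u v) ⊎ (X v × Arc o v u)
      E? : ∀ u v → Dec (E u v)
      E? u v = (X? u ×-dec arc? o u v) ⊎-dec (X? v ×-dec arc? o v u)
      H : Sub n
      H = mkSub X X? E E?
      H⊆G : IsSubgraph G H
      H⊆G = isSubgraph
        (λ u v t → entry⁺ X X? E E? (Sum.swap (entry⁻ X X? E E? {u} t)))
        (λ u v t → edges (entry⁻ X X? E E? {u} t))
        (λ u v t → ∈-subset⁺ X? (ends (entry⁻ X X? E E? {u} t)))
        where
        edges : ∀ {u v} → E u v → u ~ v
        edges (inj₁ (_ , e , _)) = e
        edges (inj₂ (_ , e , _)) = Graph.sym G e
        ends : ∀ {u v} → E u v → X u
        ends (inj₁ (x , _)) = x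
        ends (inj₂ (x , a)) = closed x a
      f? : ∀ d → Dec (X (src d) × O o d)
      f? d = X? (src d) ×-dec O? o d
      once : ∀ d (p : Dec (X (src d) × O o d)) (q : Dec (X (tgt d) × O o (rev d))) →
             ⟦ p ⟧ + ⟦ q ⟧ ≤ ⟦ T? (Sub.entry H (src d) (tgt d)) ⟧
      once d (yes (_ , p)) (yes (_ , q)) = contradiction q (asym o p)
      once d (yes (x , p)) (no _) = ≤-reflexive (sym (⟦⟧-yes (T? _) (entry⁺ X X? E E? (inj₁ (x , edge d , p)))))
      once d (no _) (yes (x , q)) = ≤-reflexive (sym (⟦⟧-yes (T? _) (entry⁺ X X? E E? (inj₂ (x , edge (rev d) , q)))))
      once d (no _) (no _)        = z≤n
      enough : ∀ v (x : Dec (X v)) → ⟦ x ⟧ * 2 ≤ ∑ darts (λ d → ⟦ src d Fin.≟ v ⟧ * ⟦ f? d ⟧)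
      enough v (no _)  = z≤n
      enough v (yes x) = ≤-trans (dense v x) (∑-mono darts (λ d →
        ≤-trans (⟦⟧-mono (out? o v d) (src d Fin.≟ v ×-dec f? d) (λ { (refl , q) → refl , x , q }))
                (≤-reflexive (⟦⟧-× (src d Fin.≟ v) (f? d)))))

    rebalance : ∀ {u} o → BalancedBut u o → ∃ λ o′ → o ⊑ o′ × Balanced o′
    rebalance {u} o bal with closedForest {E = Arc o} (arc? o) {R = _≡ u} (Fin._≟ u)
    ... | S , closed = go (Fin.any? (λ w → SearchForest.X? S w ×-dec out o w ≤? 1))
      where
      open SearchForest S
      -- Parents are followed from `w` back to `u`. Search ranks drop on the way, which is the rank
      -- condition of `Path` read forwards and also the reason for termination; `m` bounds the rank.
      backtrack : ∀ {w l} m {y} → rank y ℕ.< m → X y → Path rank w o l y → ∃ λ l → Path rank w o l u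
      backtrack zero () _ _
      backtrack (suc m) {y} lt x p with y Fin.≟ u
      ... | yes refl = _ , p
      ... | no ne with xp , (e , a) , up ← parent x ne =
        backtrack m (≤-trans up (s≤s⁻¹ lt)) xp (step (dart _ _ e) a up p)
      go : Dec (∃ λ w → X w × out o w ≤ 1) → ∃ λ o′ → o ⊑ o′ × Balanced o′
      go (yes (w , x , le)) = push rank w o (proj₂ (backtrack (suc (rank w)) ≤-refl x stop)) bal
        (λ _ → le) (λ { refl → ≤-trans le (s≤s z≤n) })
      go (no none) = ⊥-elim (dense-absurd o X? (root refl) closed (λ v x → ≰⇒> (λ le → none (v , x , le))))

    orientAll : ∀ ds → ∃ λ o → Balanced o × (∀ {d} → d ∈ ds → Oriented o d)
    orientAll [] = record { O = λ _ → ⊥ ; O? = λ _ → no id ; asym = λ () }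
                 , (λ v → ≤-trans (∑-cover {ys = []} _ darts-unique λ {d} _ h →
                     ⊥-elim (proj₂ (⟦⟧≢0⇒ (src d Fin.≟ v ×-dec no id) h))) z≤n)
                 , λ ()
    orientAll (d ∷ ds) with o , bal , all ← orientAll ds with O? o d ⊎-dec O? o (rev d)
    ... | yes done = o , bal , λ { (here refl) → done ; (there d∈) → all d∈ }
    ... | no new with o″ , o′⊑o″ , bal″ ← rebalance {src d} (insert o d new)
                        ( ≤-trans (out-mono+1 o (insert o d new) (src d) d λ { _ (inj₁ eq) → inj₁ (sym eq) ; _ (inj₂ q) → inj₂ q }) (s≤s (bal (src d)))
                        , λ v ne → ≤-trans (out-mono o (insert o d new) v λ { s (inj₁ refl) → contradiction (sym s) ne ; _ (inj₂ q) → q }) (bal v))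
      = o″ , bal″ , λ { (here refl) → o′⊑o″ d (inj₁ (inj₁ refl))
                      ; {e} (there e∈) → o′⊑o″ e (Sum.map inj₂ inj₂ (all e∈)) }

    -- The common core of both colouring results: a conflict on an edge needs a bad colour at both
    -- ends, so it is enough that the tail avoids it. With at most two outgoing darts and one bad
    -- colour for each, a list of three keeps a free colour, and the vertices can be coloured
    -- independently of each other.
    avoiding : (L : ListAssignment n 3) (bad : Dart G → List Colour) → (∀ d → length (bad d) ≤ 1) →
      ∃ λ c → c FromLists L × (∀ d → c (src d) ∉ bad d ⊎ c (tgt d) ∉ bad (rev d))
    avoiding L bad small with o , bal , all ← orientAll darts
      = (λ v → proj₁ (choice v)) , (λ v → proj₁ (proj₂ (choice v))) , λ d → Sum.map (avoid d) (avoid (rev d)) (all (∈-darts d))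
      where
      open ListAssignment L
      outDarts : Fin n → List (Dart G)
      outDarts v = filter (out? o v) darts
      forbidden : Fin n → List Colour
      forbidden v = concatMap bad (outDarts v)
      length-concatMap : ∀ ds → length (concatMap bad ds) ≤ length ds
      length-concatMap []       = z≤n
      length-concatMap (d ∷ ds) = ≤-trans (≤-reflexive (List.length-++ (bad d))) (+-mono-≤ (small d) (length-concatMap ds))
      few : ∀ v → length (forbidden v) ≤ 2
      few v = ≤-trans (length-concatMap (outDarts v)) (≤-trans (≤-reflexive (length-filter≡∑ (out? o v) darts)) (bal v))
      choice : ∀ v → ∃ λ x → x ∈ list v × x ∉ forbidden v
      choice v = pick ℤ._≟_ (unique v) (≤-trans (s≤s (few v)) (large v))
      avoid : ∀ d → O o d → proj₁ (choice (src d)) ∉ bad d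
      avoid d p c∈ = proj₂ (proj₂ (choice (src d)))
        (∈-concatMap⁺ bad (lose (∈-filter⁺ (out? o (src d)) (∈-darts d) (refl , p)) c∈))

    adaptable : AdaptablyChoosable 3 G
    adaptable F L with c , from , ok ← avoiding L (λ d → [ EdgeColouring.colour F d ]) (λ _ → ≤-refl) = c , adapted , from
      where
      adapted : Adapted G F c
      adapted d (p , q) with ok d
      ... | inj₁ c∉ = c∉ (here p)
      ... | inj₂ c∉ = c∉ (here (trans q (sym (EdgeColouring.undirected F d))))

    choosable : Choosable 3 1 G
    choosable L few = let c , from , ok = avoiding L common (λ d → few (edge d)) in c , proper c from ok , from
      where
      open ListAssignment L
      common : Dart G → List Colour
      common d = filter (λ x → DecMembership._∈?_ ℤ._≟_ x (list (tgt d))) (list (src d))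
      proper : ∀ c → c FromLists L → (∀ d → c (src d) ∉ common d ⊎ c (tgt d) ∉ common (rev d)) → Proper G c
      proper c from ok {u} {v} e eq with ok (dart u v e)
      ... | inj₁ c∉ = c∉ (∈-filter⁺ (λ x → DecMembership._∈?_ ℤ._≟_ x (list v)) (from u) (subst (_∈ list v) (sym eq) (from v)))
      ... | inj₂ c∉ = c∉ (∈-filter⁺ (λ x → DecMembership._∈?_ ℤ._≟_ x (list u)) (from v) (subst (_∈ list u) eq (from u)))

-- Maximum average degree

open import Data.Integer using (+_)

averageDegree′<4 : ∀ e v → (1 ≤ v → e ℕ.< 2 * v) → averageDegree′ e v < + 4 / 1
averageDegree′<4 e zero    _ = ℚ.*<* (ℤ.+<+ (s≤s z≤n))
averageDegree′<4 e (suc v) h = ℚ.toℚᵘ-cancel-< (ℚᵘ.<-respˡ-≃ (ℚᵘ.≃-sym (ℚ.toℚᵘ-fromℚᵘ (ℚᵘ.mkℚᵘ (+ (2 * e)) v)))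
  (ℚᵘ.*<* (subst₂ ℤ._<_ (ℤ.pos-* (2 * e) 1) (ℤ.pos-* 4 (suc v)) (ℤ.+<+ (begin-strict
    2 * e * 1             ≡⟨ *-identityʳ (2 * e) ⟩
    2 * e                   <⟨ *-monoʳ-< 2 (h (s≤s z≤n)) ⟩
    2 * (2 * suc v)       ≡⟨ *-assoc 2 2 (suc v) ⟨
    4 * suc v               ∎)))))
  where open ≤-Reasoning

∣∣-nonempty : ∀ {n} (p : Subset.Subset n) → 1 ≤ ∣ p ∣ → Subset.Nonempty p
∣∣-nonempty {n} p 1≤ with Subset.nonempty? p
... | yes ne = ne
... | no  em = contradiction (subst (1 ≤_) (trans (cong ∣_∣ (Subset.Empty-unique em)) (Subset.∣⊥∣≡0 n)) 1≤) λ ()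

mad<4 : ∀ {n} {G : Graph n} → Sparse G → mad G < + 4 / 1
mad<4 {n} {G} sparse = ℚ.≰⇒> λ 4≤mad → proj₂ bound (ℚ.≤-antisym (proj₁ bound) 4≤mad)
  where
  -- The strict order in which `max<v⁺` is stated is `≤` together with `≢`, hence the pairs.
  each : All (λ q → q ℚ.≤ + 4 / 1 × q ≢ + 4 / 1) (map averageDegree (subgraphs G))
  each = All.map⁺ (All.tabulate λ {H} H∈ →
    let lt = averageDegree′<4 (edgeCount (Sub.entry H)) ∣ Sub.vertices H ∣
               (λ 1≤ → sparse H (proj₂ (∈-filter⁻ (isSubgraph? G) {xs = cartesianProductWith sub (allSubsets n) (allVecs (allSubsets n) n)} H∈)) (proj₂ (∣∣-nonempty (Sub.vertices H) 1≤)))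
    in ℚ.<⇒≤ lt , ℚ.<⇒≢ lt)
  zero<4 : ℚ.0ℚ < + 4 / 1
  zero<4 = ℚ.*<* (ℤ.+<+ (s≤s z≤n))
  bound = max<v⁺ {⊥ = ℚ.0ℚ} (ℚ.<⇒≤ zero<4 , ℚ.<⇒≢ zero<4) each

theorem4 : ∀ (n : ℕ) (G : Graph n) →
    Planar G →
    NoTriangleAdjacentToTriangle G →
    NoTriangleAdjacentTo4Cycle G →
    5CyclesAdjacentToAtMost3Triangles G →
    mad G < + 4 / 1 × AdaptablyChoosable 3 G × Choosable 3 1 G
theorem4 n G planar noTT noT4 five = mad<4 sparse , Orienting.adaptable G sparse , Orienting.choosable G sparse
  where
  sparse : Sparse G
  sparse H H⊆G v∈ = Subgraph.edge-bound planar H H⊆G v∈ noTT noT4 five
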